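{- Let $(A,B)$ be an interpolation problem. Let $a+b\le c$ be a mixed literal with auxiliary variable $x_2$, and let $x_1$ be the auxiliary variable of the negated literal $\lnot(a+b\le c)$. Suppose that $I_1[LA(c_1x_1+s_1(\vec x),k_1,F_1(x_1,\vec x))]$ is a partial interpolant of the clause $C_1\lor a+b\le c$ and that $I_2[LA(c_2x_2+s_2(\vec x),k_2,F_2(x_2,\vec x))]$ is a partial interpolant of the clause $C_2\lor\lnot(a+b\le c)$, where the displayed $LA$-sub-formulae occur only positively, $x_1$ (respectively $x_2$) occurs in the first (respectively second) partial interpolant only inside the displayed $LA$-sub-formula, and $\vec x$ denotes the other auxiliary variables of mixed inequality literals. Let $$s_3(\vec x):=c_2s_1(\vec x)+c_1s_2(\vec x).$$ In the integer case let $k_3:=c_2k_1+c_1k_2+c_1c_2$ and $$F_3(\vec x):\equiv\bigvee_{i=0}^{\left\lceil\frac{k_1+1}{c_1}\right\rceil}F_1\!\left(\left\lfloor\tfrac{ -s_1(\vec x)}{c_1}\right\rfloor-i,\vec x\right)\land F_2\!\left(i-\left\lfloor\tfrac{ -s_1(\vec x)}{c_1}\right\rfloor,\vec x\right).$$ In the real case let, if $k_1=-\varepsilon$, $k_3:=k_2$ and $F_3(\vec x):\equiv F_2\!\left(\tfrac{s_1(\vec x)}{c_1},\vec x\right)$; and, if $k_1=0$, $k_3:=0$ and $F_3(\vec x):\equiv s_3(\vec x)<0\lor\left(F_1\!\left(-\tfrac{s_1(\vec x)}{c_1},\vec x\right)\land F_2\!\left(\tfrac{s_1(\vec x)}{c_1},\vec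 x\right)\right)$. Then $I_1[I_2[LA(s_3(\vec x),k_3,F_3(\vec x))]]$ is a partial interpolant of the clause $C_1\lor C_2$.
   Context: Formulae are quantifier-free first-order formulae in the combined theory of equality with uninterpreted functions and linear arithmetic over $\mathbb{Q}$ and $\mathbb{Z}$ (with the integer division-by-constant functions $\lfloor\cdot/k\rfloor$, $k\ge 1$, in the signature); $\models$ is entailment in this theory. $\mathrm{symb}(F)$ is the set of non-theory symbols of $F$. An interpolation problem is a pair $(A,B)$ of formulae with $A\land B\models\bot$. A symbol is shared if it is in $\mathrm{symb}(A)\cap\mathrm{symb}(B)$, $A$-local if in $\mathrm{symb}(A)\setminus\mathrm{symb}(B)$, $B$-local if in $\mathrm{symb}(B)\setminus\mathrm{symb}(A)$. A term/literal is $A$-local ($B$-local) if it contains at least one $A$-local ($B$-local) symbol and no $B$-local ($A$-local) symbol, shared if it contains only shared symbols, mixed if it contains both $A$-local and $B$-local symbols. Arithmetic. In the integer case all variables and terms are integer-valued, inequality literals are $s\le c$ with $s$ a linear combination with integer coefficients and $c\in\mathbb{Z}$, and $s<c$ means $s\le c-1$. In the real case variables range over $\mathbb{Q}$ and constants over $\mathbb{Q}_\varepsilon=\mathbb{Q}\cup\{q-\varepsilon\mid q\in\mathbb{Q}\}$, where $s\le q-\varepsilon$ means $s<q$; accordingly "$s<\varepsilon$" means $s\le 0$. In the integer case $-\varepsilon$ stands for $-1$. For readability, $s > 0$, $s<-k$ etc. are used in this sense. Projections. Each literal $\ell$ has projections $\ell\downharpoonright A$, $\ell\downharpoonright B$,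 extended to conjunctions of literals component-wise. For non-mixed literals: if $\ell$ is $A$-local, $\ell\downharpoonright A=\ell$ and $\ell\downharpoonright B=\top$; if $\ell$ is $B$-local, $\ell\downharpoonright A=\top$ and $\ell\downharpoonright B=\ell$; if $\ell$ is shared, then either (Pudlák) $\ell\downharpoonright A=\ell\downharpoonright B=\ell$, or (McMillan) $\ell\downharpoonright A=\top$, $\ell\downharpoonright B=\ell$, the choice being fixed throughout. For mixed literals, fresh auxiliary variables are used: for $a$ $A$-local and $b$ $B$-local, $(a=b)\downharpoonright A := (a=x)$, $(a=b)\downharpoonright B := (x=b)$, $(a\neq b)\downharpoonright A := (p_x \mathrel{\mathrm{xor}} (a=x))$, $(a\neq b)\downharpoonright B := (\lnot p_x \mathrel{\mathrm{xor}} (x=b))$ ($p_x$ Boolean); for a mixed inequality $a+b\le c$, where $a$ is a linear combination of $A$-local variables, $b$ a linear combination of $B$-local and shared variables and $c$ a constant, with auxiliary variable $x$: $(a+b\le c)\downharpoonright A := (a+x\le 0)$ and $(a+b\le c)\downharpoonright B := (-x+b\le c)$. The negation of a mixed inequality is again a mixed inequality and has a different auxiliary variable. Thus for the pivot here: $(a+b\le c)\downharpoonright A=(a+x_2\le0)$, $(a+b\le c)\downharpoonright B=(-x_2+b\le c)$, $\lnot(a+b\le c)\downharpoonright A=(-a+x_1\le0)$, $\lnot(a+b\le c)\downharpoonright B=(-x_1-b<-c)$, i.e. $\lnot(x_1+b\le c)$. Auxiliary variables belonging to different literals are distinct (except that $a=b$ and $a\ne b$ share $x$), are fresh (do not occur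 in $A$, $B$ or the clauses), have the same type as the terms in the literal, and count as shared symbols. Partial interpolant. A partial interpolant of a clause $C$ is a formula $I$ that is an interpolant of $A\land(\lnot C\downharpoonright A)$ and $B\land(\lnot C\downharpoonright B)$, i.e. (i) $A\land\lnot C\downharpoonright A\models I$, (ii) $B\land\lnot C\downharpoonright B\land I\models\bot$, (iii) every non-theory symbol of $I$ is in $\mathrm{symb}(A)\cap\mathrm{symb}(B)$ or is an auxiliary variable introduced by the projections of the literals of $\lnot C$. $LA$-pattern. The expression $LA(s(\vec y),k,F(\vec y))$, where $\vec y$ is a vector of auxiliary variables, denotes the formula $F(\vec y)$ and merely records $s$ and $k$. It is only used when: $s$ is a linear term over $\vec y$ and arbitrary other terms not involving $\vec y$, in which the coefficients of the variables $\vec y$ are positive (so in particular $c_1,c_2>0$); $k\in\{0,-\varepsilon\}$ in the real case and $k\in\mathbb{Z}$, $k\ge-1$ in the integer case; $F$ is monotone, i.e. $\vec y\ge\vec y'$ (component-wise) implies $F(\vec y)\rightarrow F(\vec y')$; $F(\vec y)=\bot$ whenever $s(\vec y)>0$; and $F(\vec y)=\top$ whenever $s(\vec y)<-k$. In a partial interpolant, auxiliary variables of mixed inequality literals occur only inside such $LA$-sub-formulae. $F[G]$ denotes a formula in negation normal form with a sub-formula $G$ occurring positively; $F[G']$ is the result of replacing $G$ by $G'$. $C_1,C_2$ contain neither the pivot literal nor its negation.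
   Formalization: Condition (iii) on partial interpolants is also required of, and proved for, the symbols of the recorded term s in LA(s,k,F), not only those of F; otherwise F₃ could contain local symbols coming from s₁. -}

module Defs where

open import Data.Bool.Base using (Bool; T)
open import Data.Empty using (⊥; ⊥-elim)
open import Data.Integer.Base as ℤ using (ℤ; +_; 0ℤ; 1ℤ; -1ℤ)
open import Data.List.Base using (List; []; _∷_; _++_; map; concatMap; foldr; upTo)
open import Data.List.Membership.Propositional using (_∈_; _∉_)
open import Data.List.Relation.Ternary.Interleaving.Propositional using (Interleaving)
open import Data.List.Relation.Unary.All using (All; []; _∷_)
open import Data.List.Relation.Unary.Any using (Any)
open import Data.Maybe.Base using (Maybe; maybe)
open import Data.Nat.Base as ℕ using (ℕ; suc; NonZero)
open import Data.Nat.Properties as ℕ using (m*n≢0)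
open import Data.Product using (_×_; _,_; ∃)
open import Data.Rational.Base as ℚ using (ℚ; 0ℚ; 1ℚ; 1/_)
open import Data.Rational.Properties as ℚ using (pos⇒nonZero; pos*pos⇒pos)
open import Data.Sign.Base as Sign using (Sign; opposite)
open import Data.Sum using (_⊎_)
open import Data.Unit using (⊤)
open import Function.Definitions using (Injective)
open import Relation.Binary.Definitions using (DecidableEquality)
open import Relation.Binary.PropositionalEquality using (_≡_; refl)
open import Relation.Nullary using (¬_; yes; no)
import Data.List.Membership.DecPropositional ℕ._≟_ as ℕ∈

infixl 7 _*ᵛ_ _·_
infixl 6 _+ᵛ_ _+ᴾ_
infix  4 _≤ᵛ_ _<ᵛ_ _≤ᵇ_ _<-_ _≈_ _≤_ _⊨_ _⊨ᶠ_
infixr 5 _∧_ _∨_ _∧ⁿ_ _∨ⁿ_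
infix  9 _[_]

data Num : Set where
  int rat : Num

Val : Num → Set
Val int = ℤ
Val rat = ℚ

0ᵛ 1ᵛ : ∀ {τ} → Val τ
0ᵛ {int} = 0ℤ
0ᵛ {rat} = 0ℚ
1ᵛ {int} = 1ℤ
1ᵛ {rat} = 1ℚ

_+ᵛ_ _*ᵛ_ : ∀ {τ} → Val τ → Val τ → Val τ
_+ᵛ_ {int} = ℤ._+_
_+ᵛ_ {rat} = ℚ._+_
_*ᵛ_ {int} = ℤ._*_
_*ᵛ_ {rat} = ℚ._*_

-ᵛ_ : ∀ {τ} → Val τ → Val τ
-ᵛ_ {int} = ℤ.-_
-ᵛ_ {rat} = ℚ.-_

_≤ᵛ_ _<ᵛ_ : ∀ {τ} → Val τ → Val τ → Set
_≤ᵛ_ {int} = ℤ._≤_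
_≤ᵛ_ {rat} = ℚ._≤_
_<ᵛ_ {int} = ℤ._<_
_<ᵛ_ {rat} = ℚ._<_

data ℚε : Set where
  exact : ℚ → ℚε
  _-ε   : ℚ → ℚε

Bound : Num → Set
Bound int = ℤ
Bound rat = ℚε

_≤ᵇ_ : ∀ {τ} → Val τ → Bound τ → Set
_≤ᵇ_ {int} v c         = v ℤ.≤ c
_≤ᵇ_ {rat} v (exact q) = v ℚ.≤ q
_≤ᵇ_ {rat} v (q -ε)    = v ℚ.< q

0ᵇ : ∀ {τ} → Bound τ
0ᵇ {int} = 0ℤ
0ᵇ {rat} = exact 0ℚ

Pos : Num → Set
Pos int = ∃ λ (n : ℕ) → NonZero n
Pos rat = ∃ λ (q : ℚ) → ℚ.Positive q

val : ∀ {τ} → Pos τ → Val τ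
val {int} (n , _) = + n
val {rat} (q , _) = q

_*⁺_ : ∀ {τ} → Pos τ → Pos τ → Pos τ
_*⁺_ {int} (m , m≢0) (n , n≢0) = m ℕ.* n , m*n≢0 m n {{m≢0}} {{n≢0}}
_*⁺_ {rat} (p , p>0) (q , q>0) = p ℚ.* q , pos*pos⇒pos p {{p>0}} q {{q>0}}

data Slackℚ : Set where
  zero minus-ε : Slackℚ

Slack : Num → Set
Slack int = ℤ
Slack rat = Slackℚ

ValidSlack : ∀ {τ} → Slack τ → Set
ValidSlack {int} k = -1ℤ ℤ.≤ k
ValidSlack {rat} k = ⊤

-- v <- k  stands for  v < -k; for k = -ε this is v < ε, i.e. v ≤ 0.
_<-_ : ∀ {τ} → Val τ → Slack τ → Set
_<-_ {int} v k       = v ℤ.< ℤ.- k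
_<-_ {rat} v zero    = v ℚ.< 0ℚ
_<-_ {rat} v minus-ε = v ℚ.≤ 0ℚ

data Sort : Set where
  num           : Num → Sort
  uninterpreted : ℕ → Sort

_≟ˢ_ : DecidableEquality Sort
num int ≟ˢ num int = yes refl
num int ≟ˢ num rat = no λ ()
num rat ≟ˢ num int = no λ ()
num rat ≟ˢ num rat = yes refl
num _ ≟ˢ uninterpreted _ = no λ ()
uninterpreted _ ≟ˢ num _ = no λ ()
uninterpreted m ≟ˢ uninterpreted n with m ℕ.≟ n
... | yes refl = yes refl
... | no  m≢n  = no λ { refl → m≢n refl }

-- A non-theory symbol is a name together with its type, so there are
-- infinitely many symbols of every type.
data Symbol : Set where
  fun  : ℕ → List Sort → Sort → Symbol
  pred : ℕ → List Sort → Symbol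

var : Sort → ℕ → Symbol
var s x = fun x [] s

data Term : Sort → Set where
  app   : (f : ℕ) {ds : List Sort} {s : Sort} → All Term ds → Term s
  const : ∀ {τ} → Val τ → Term (num τ)
  lin   : ∀ {τ} → List (Val τ × Term (num τ)) → Term (num τ)
  ⌊_/_⌋ : Term (num int) → (k : ℕ) .{{_ : NonZero k}} → Term (num int)

-- Linear combinations, read as the sum of cᵢ · tᵢ.
Lin : Num → Set
Lin τ = List (Val τ × Term (num τ))

⟨_⟩ : ∀ {s} → ℕ → Term s
⟨ x ⟩ = app x []

_·_ : ∀ {τ} → Val τ → Lin τ → Lin τ
c · []            = []
c · ((d , t) ∷ L) = (c *ᵛ d , t) ∷ (c · L)

-ˡ_ : ∀ {τ} → Lin τ → Lin τ
-ˡ L = (-ᵛ 1ᵛ) · L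

data Atom : Set where
  _≈_  : ∀ {s} → Term s → Term s → Atom
  _≤_  : ∀ {τ} → Lin τ → Bound τ → Atom
  pred : (p : ℕ) {ds : List Sort} → All Term ds → Atom

data Formula : Set where
  ⊤ᶠ ⊥ᶠ   : Formula
  atom    : Atom → Formula
  ¬ᶠ_     : Formula → Formula
  _∧_ _∨_ : Formula → Formula → Formula

_xor_ : Formula → Formula → Formula
φ xor ψ = (φ ∧ (¬ᶠ ψ)) ∨ ((¬ᶠ φ) ∧ ψ)

Literal : Set
Literal = Sign × Atom

negate : Literal → Literal
negate (σ , α) = opposite σ , α

atomOf : Literal → Atom
atomOf (σ , α) = α

literal : Literal → Formula
literal (Sign.+ , α) = atom α
literal (Sign.- , α) = ¬ᶠ atom α

Clause : Set
Clause = List Literal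

symbTerm  : ∀ {s} → Term s → List Symbol
symbTerms : ∀ {ds} → All Term ds → List Symbol
symbLin   : ∀ {τ} → Lin τ → List Symbol

symbTerm (app f {ds} {s} ts) = fun f ds s ∷ symbTerms ts
symbTerm (const c)           = []
symbTerm (lin L)             = symbLin L
symbTerm ⌊ t / k ⌋           = symbTerm t

symbTerms []       = []
symbTerms (t ∷ ts) = symbTerm t ++ symbTerms ts

symbLin []            = []
symbLin ((c , t) ∷ L) = symbTerm t ++ symbLin L

symbAtom : Atom → List Symbol
symbAtom (t ≈ u)          = symbTerm t ++ symbTerm u
symbAtom (L ≤ c)          = symbLin L
symbAtom (pred p {ds} ts) = pred p ds ∷ symbTerms ts

symbLiteral : Literal → List Symbol
symbLiteral (σ , α) = symbAtom α

symbClause : Clause → List Symbol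
symbClause = concatMap symbLiteral

symb : Formula → List Symbol
symb ⊤ᶠ       = []
symb ⊥ᶠ       = []
symb (atom α) = symbAtom α
symb (¬ᶠ φ)   = symb φ
symb (φ ∧ ψ)  = symb φ ++ symb ψ
symb (φ ∨ ψ)  = symb φ ++ symb ψ

SortVal : (ℕ → Set) → Sort → Set
SortVal Carrier (num τ)           = Val τ
SortVal Carrier (uninterpreted u) = Carrier u

-- Decidable equality on the carriers and Bool-valued predicates are, from a
-- classical point of view, no restriction on the class of structures.
record Structure : Set₁ where
  field
    Carrier : ℕ → Set
    _≟_     : ∀ {u} → DecidableEquality (Carrier u)
    funᴵ    : (f : ℕ) (ds : List Sort) (s : Sort) →
              All (SortVal Carrier) ds → SortVal Carrier s
    predᴵ   : (p : ℕ) (ds : List Sort) → All (SortVal Carrier) ds → Bool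

  ⟦_⟧ˢ : Sort → Set
  ⟦_⟧ˢ = SortVal Carrier

module _ (M : Structure) where
  open Structure M

  ⟦_⟧  : ∀ {s} → Term s → ⟦ s ⟧ˢ
  ⟦_⟧* : ∀ {ds} → All Term ds → All ⟦_⟧ˢ ds
  ⟦_⟧ˡ : ∀ {τ} → Lin τ → Val τ

  ⟦ app f {ds} {s} ts ⟧ = funᴵ f ds s ⟦ ts ⟧*
  ⟦ const c ⟧           = c
  ⟦ lin L ⟧             = ⟦ L ⟧ˡ
  ⟦ ⌊ t / k ⌋ ⟧         = ⟦ t ⟧ ℤ./ℕ k

  ⟦ [] ⟧*     = []
  ⟦ t ∷ ts ⟧* = ⟦ t ⟧ ∷ ⟦ ts ⟧*

  ⟦ [] ⟧ˡ          = 0ᵛ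
  ⟦ (c , t) ∷ L ⟧ˡ = (c *ᵛ ⟦ t ⟧) +ᵛ ⟦ L ⟧ˡ

  ⟦_⟧ᵃ : Atom → Set
  ⟦ t ≈ u ⟧ᵃ          = ⟦ t ⟧ ≡ ⟦ u ⟧
  ⟦ L ≤ c ⟧ᵃ          = ⟦ L ⟧ˡ ≤ᵇ c
  ⟦ pred p {ds} ts ⟧ᵃ = T (predᴵ p ds ⟦ ts ⟧*)

_⊨ᶠ_ : Structure → Formula → Set
M ⊨ᶠ ⊤ᶠ      = ⊤
M ⊨ᶠ ⊥ᶠ      = ⊥
M ⊨ᶠ atom α  = ⟦ M ⟧ᵃ α
M ⊨ᶠ (¬ᶠ φ)  = ¬ (M ⊨ᶠ φ)
M ⊨ᶠ (φ ∧ ψ) = M ⊨ᶠ φ × M ⊨ᶠ ψ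
M ⊨ᶠ (φ ∨ ψ) = M ⊨ᶠ φ ⊎ M ⊨ᶠ ψ

_⊨_ : Formula → Formula → Set₁
φ ⊨ ψ = ∀ (M : Structure) → M ⊨ᶠ φ → M ⊨ᶠ ψ

-- M with the variables of sort num τ named in ys reinterpreted by ρ.
assign : (M : Structure) (τ : Num) → List ℕ → (ℕ → Val τ) → Structure
assign M τ ys ρ = record
  { Carrier = Carrier ; _≟_ = _≟_ ; funᴵ = funᴵ′ ; predᴵ = predᴵ }
  where
  open Structure M
  funᴵ′ : (f : ℕ) (ds : List Sort) (s : Sort) → All ⟦_⟧ˢ ds → ⟦ s ⟧ˢ
  funᴵ′ f [] s vs with s ≟ˢ num τ | f ℕ∈.∈? ys
  ... | yes refl | yes _ = ρ f
  ... | _        | _     = funᴵ f [] s vs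
  funᴵ′ f (d ∷ ds) s vs = funᴵ f (d ∷ ds) s vs

data NNF (X : Set) : Set where
  leaf      : X → NNF X
  lit       : Literal → NNF X
  ⊤ⁿ ⊥ⁿ     : NNF X
  _∧ⁿ_ _∨ⁿ_ : NNF X → NNF X → NNF X

formulaNNF : ∀ {X} → (X → Formula) → NNF X → Formula
formulaNNF f (leaf x) = f x
formulaNNF f (lit ℓ)  = literal ℓ
formulaNNF f ⊤ⁿ       = ⊤ᶠ
formulaNNF f ⊥ⁿ       = ⊥ᶠ
formulaNNF f (φ ∧ⁿ ψ) = formulaNNF f φ ∧ formulaNNF f ψ
formulaNNF f (φ ∨ⁿ ψ) = formulaNNF f φ ∨ formulaNNF f ψ

leaves : ∀ {X} → NNF X → List X
leaves (leaf x) = x ∷ []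
leaves (lit ℓ)  = []
leaves ⊤ⁿ       = []
leaves ⊥ⁿ       = []
leaves (φ ∧ⁿ ψ) = leaves φ ++ leaves ψ
leaves (φ ∨ⁿ ψ) = leaves φ ++ leaves ψ

symbLits : ∀ {X} → NNF X → List Symbol
symbLits (leaf x) = []
symbLits (lit ℓ)  = symbLiteral ℓ
symbLits ⊤ⁿ       = []
symbLits ⊥ⁿ       = []
symbLits (φ ∧ⁿ ψ) = symbLits φ ++ symbLits ψ
symbLits (φ ∨ⁿ ψ) = symbLits φ ++ symbLits ψ

_>>=_ : ∀ {X Y} → NNF X → (X → NNF Y) → NNF Y
leaf x   >>= f = f x
lit ℓ    >>= f = lit ℓ
⊤ⁿ       >>= f = ⊤ⁿ
⊥ⁿ       >>= f = ⊥ⁿ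
(φ ∧ⁿ ψ) >>= f = (φ >>= f) ∧ⁿ (ψ >>= f)
(φ ∨ⁿ ψ) >>= f = (φ >>= f) ∨ⁿ (ψ >>= f)

Body : Set
Body = NNF ⊥

formulaBody : Body → Formula
formulaBody = formulaNNF ⊥-elim

⋁ : List Body → Body
⋁ = foldr _∨ⁿ_ ⊥ⁿ

-- F ⟨ x ∶ τ ≔ u ⟩ is F(u) for F = F(x), where x is a variable of sort num τ.
module _ (x : ℕ) (τ : Num) (u : Term (num τ)) where

  substTerm  : ∀ {s} → Term s → Term s
  substTerms : ∀ {ds} → All Term ds → All Term ds
  substLin   : ∀ {τ′} → Lin τ′ → Lin τ′

  substTerm (app f {[]} {s} []) with s ≟ˢ num τ | f ℕ.≟ x
  ... | yes refl | yes _ = u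
  ... | _        | _     = app f []
  substTerm (app f {d ∷ ds} ts) = app f (substTerms ts)
  substTerm (const c)           = const c
  substTerm (lin L)             = lin (substLin L)
  substTerm ⌊ t / k ⌋           = ⌊ substTerm t / k ⌋

  substTerms []       = []
  substTerms (t ∷ ts) = substTerm t ∷ substTerms ts

  substLin []            = []
  substLin ((c , t) ∷ L) = (c , substTerm t) ∷ substLin L

  substAtom : Atom → Atom
  substAtom (t ≈ v)     = substTerm t ≈ substTerm v
  substAtom (L ≤ c)     = substLin L ≤ c
  substAtom (pred p ts) = pred p (substTerms ts)

  substNNF : ∀ {X} → NNF X → NNF X
  substNNF (leaf y)      = leaf y
  substNNF (lit (σ , α)) = lit (σ , substAtom α)
  substNNF ⊤ⁿ            = ⊤ⁿ
  substNNF ⊥ⁿ            = ⊥ⁿ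
  substNNF (φ ∧ⁿ ψ)      = substNNF φ ∧ⁿ substNNF ψ
  substNNF (φ ∨ⁿ ψ)      = substNNF φ ∨ⁿ substNNF ψ

_⟨_∶_≔_⟩ : Body → ℕ → (τ : Num) → Term (num τ) → Body
F ⟨ x ∶ τ ≔ u ⟩ = substNNF x τ u F

-- The term s(y⃗): a linear combination of the variables y⃗ with positive
-- coefficients, plus a linear combination of other terms.
record LATerm (τ : Num) : Set where
  constructor _⊹_
  field
    posVars : List (Pos τ × ℕ)
    others  : Lin τ

open LATerm public

names : ∀ {τ} → LATerm τ → List ℕ
names s = map (λ { (c , y) → y }) (posVars s)

linLA : ∀ {τ} → LATerm τ → Lin τ
linLA (ys ⊹ L) = map (λ { (c , y) → val c , ⟨ y ⟩ }) ys ++ L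

_·ᵖ_+ᴾ_ : ∀ {τ} → Pos τ → ℕ → LATerm τ → LATerm τ
c ·ᵖ x +ᴾ (ys ⊹ L) = ((c , x) ∷ ys) ⊹ L

_*ᴾ_ : ∀ {τ} → Pos τ → LATerm τ → LATerm τ
c *ᴾ (ys ⊹ L) = map (λ { (d , y) → c *⁺ d , y }) ys ⊹ (val c · L)

_+ᴾ_ : ∀ {τ} → LATerm τ → LATerm τ → LATerm τ
(ys ⊹ L) +ᴾ (zs ⊹ K) = (ys ++ zs) ⊹ (L ++ K)

record LAPattern : Set where
  constructor LA
  field
    {sort} : Num
    s      : LATerm sort
    k      : Slack sort
    F      : Body

-- An interpolant keeps its LA-patterns as syntax, since s and k are used
-- when resolving; formulaLA gives the formula it denotes.
LAFormula : Set
LAFormula = NNF LAPattern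

formulaLA : LAFormula → Formula
formulaLA = formulaNNF (λ P → formulaBody (LAPattern.F P))

symbLAPattern : LAPattern → List Symbol
symbLAPattern (LA s k F) = symbLin (linLA s) ++ symbLits F

symbLA : LAFormula → List Symbol
symbLA I = symbLits I ++ concatMap symbLAPattern (leaves I)

-- I[·]: the hole is the leaf  nothing.  All leaves of an NNF are positive.
Context : Set
Context = NNF (Maybe LAPattern)

_[_] : Context → LAFormula → LAFormula
I [ G ] = I >>= maybe leaf G

symbContext : Context → List Symbol
symbContext I = symbLits I ++ concatMap (maybe symbLAPattern []) (leaves I)

-- ineq σ L c is the variable of the literal with sign σ and atom L ≤ c;
-- eq a b is the variable x shared by a = b and a ≠ b, and bool a b the
-- variable p_x of a ≠ b, where a is the A-local side.
data AuxKey : Set where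
  ineq : ∀ {τ} → Sign → Lin τ → Bound τ → AuxKey
  eq   : ∀ {s} → Term s → Term s → AuxKey
  bool : ∀ {s} → Term s → Term s → AuxKey

namedSymbol : (AuxKey → ℕ) → AuxKey → Symbol
namedSymbol name κ@(ineq {τ} _ _ _) = var (num τ) (name κ)
namedSymbol name κ@(eq {s} _ _)     = var s (name κ)
namedSymbol name κ@(bool _ _)       = pred (name κ) []

record AuxNaming : Set where
  field
    name     : AuxKey → ℕ
    distinct : Injective _≡_ _≡_ (namedSymbol name)

  auxSymbol : AuxKey → Symbol
  auxSymbol = namedSymbol name

  data IneqAux : Symbol → Set where
    ineqAux : ∀ {τ} σ (L : Lin τ) c → IneqAux (auxSymbol (ineq σ L c))

  -- The conditions under which LA(s(y⃗), k, F(y⃗)) may be used, where y⃗ are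
  -- the auxiliary variables of mixed inequalities occurring in it.
  record WellFormed (P : LAPattern) : Set₁ where
    open LAPattern P
    field
      aux-vars    : All (λ y → IneqAux (var (num sort) y)) (names s)
      others-free : ∀ {z} → z ∈ symbLin (others s) → ¬ IneqAux z
      F-vars      : ∀ {z} → z ∈ symbLits F → IneqAux z →
                    z ∈ map (var (num sort)) (names s)
      slack       : ValidSlack k
      monotone    : ∀ M (ρ ρ′ : ℕ → Val sort) →
                    (∀ {y} → y ∈ names s → ρ′ y ≤ᵛ ρ y) →
                    assign M sort (names s) ρ  ⊨ᶠ formulaBody F →
                    assign M sort (names s) ρ′ ⊨ᶠ formulaBody F
      F-⊥         : ∀ M → 0ᵛ <ᵛ ⟦ M ⟧ˡ (linLA s) → ¬ (M ⊨ᶠ formulaBody F)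
      F-⊤         : ∀ M → ⟦ M ⟧ˡ (linLA s) <- k → M ⊨ᶠ formulaBody F

record InterpolationProblem : Set₁ where
  field
    A B   : Formula
    unsat : (A ∧ B) ⊨ ⊥ᶠ

data Style : Set where
  pudlák mcmillan : Style

shared↓A : Style → Literal → Formula
shared↓A pudlák   ℓ = literal ℓ
shared↓A mcmillan ℓ = ⊤ᶠ

module Interpolation (style : Style) (problem : InterpolationProblem)
                     (aux : AuxNaming) where
  open InterpolationProblem problem
  open AuxNaming aux

  ALocalSymbol BLocalSymbol SharedSymbol : Symbol → Set
  ALocalSymbol z = z ∈ symb A × z ∉ symb B
  BLocalSymbol z = z ∈ symb B × z ∉ symb A
  SharedSymbol z = z ∈ symb A × z ∈ symb B

  ALocal BLocal Shared Mixed : List Symbol → Set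
  ALocal zs = Any ALocalSymbol zs × All (λ z → ¬ BLocalSymbol z) zs
  BLocal zs = Any BLocalSymbol zs × All (λ z → ¬ ALocalSymbol z) zs
  Shared zs = All SharedSymbol zs
  Mixed  zs = Any ALocalSymbol zs × Any BLocalSymbol zs

  -- L = a + b with the summands in any order.
  record MixedSplit {τ} (L : Lin τ) : Set where
    field
      a b     : Lin τ
      split   : Interleaving a b L
      a-local : All (λ { (_ , t) → ALocal (symbTerm t) }) a
      b-rest  : All (λ { (_ , t) → BLocal (symbTerm t) ⊎ Shared (symbTerm t) }) b
      mixed   : Mixed (symbLin L)

  -- A literal has projections only if it is non-mixed or mixed in one of the
  -- forms below; a and b are on either side of an equality.
  data Projectable : Atom → Set where
    a-local : ∀ {α} → ALocal (symbAtom α) → Projectable α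
    b-local : ∀ {α} → BLocal (symbAtom α) → Projectable α
    shared  : ∀ {α} → Shared (symbAtom α) → Projectable α
    mixed-≈ : ∀ {s} {a b : Term s} →
              ALocal (symbTerm a) → BLocal (symbTerm b) → Projectable (a ≈ b)
    mixed-≈˘ : ∀ {s} {a b : Term s} →
              ALocal (symbTerm a) → BLocal (symbTerm b) → Projectable (b ≈ a)
    mixed-≤ : ∀ {τ} {L : Lin τ} {c} → MixedSplit L → Projectable (L ≤ c)

  ProjectableClause : Clause → Set
  ProjectableClause = All (λ ℓ → Projectable (atomOf ℓ))

  eq↓A eq↓B : ∀ {s} → Sign → Term s → Term s → Formula
  eq↓A Sign.+ a b = atom (a ≈ ⟨ name (eq a b) ⟩)
  eq↓A Sign.- a b = atom (pred (name (bool a b)) []) xor atom (a ≈ ⟨ name (eq a b) ⟩)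
  eq↓B Sign.+ a b = atom (⟨ name (eq a b) ⟩ ≈ b)
  eq↓B Sign.- a b = (¬ᶠ atom (pred (name (bool a b)) [])) xor atom (⟨ name (eq a b) ⟩ ≈ b)

  ineq↓A ineq↓B : ∀ {τ} (σ : Sign) (L : Lin τ) → Bound τ → MixedSplit L → Formula
  ineq↓A σ@Sign.+ L c m =
    atom ((MixedSplit.a m ++ (1ᵛ , ⟨ name (ineq σ L c) ⟩) ∷ []) ≤ 0ᵇ)
  ineq↓A σ@Sign.- L c m =
    atom (((-ˡ MixedSplit.a m) ++ (1ᵛ , ⟨ name (ineq σ L c) ⟩) ∷ []) ≤ 0ᵇ)
  ineq↓B σ@Sign.+ L c m =
    atom (((-ᵛ 1ᵛ , ⟨ name (ineq σ L c) ⟩) ∷ MixedSplit.b m) ≤ c)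
  ineq↓B σ@Sign.- L c m =
    ¬ᶠ atom (((1ᵛ , ⟨ name (ineq σ L c) ⟩) ∷ MixedSplit.b m) ≤ c)

  projA : ∀ ℓ → Projectable (atomOf ℓ) → Formula
  projA ℓ       (a-local _)                = literal ℓ
  projA ℓ       (b-local _)                = ⊤ᶠ
  projA ℓ       (shared _)                 = shared↓A style ℓ
  projA (σ , _) (mixed-≈ {a = a} {b} _ _)  = eq↓A σ a b
  projA (σ , _) (mixed-≈˘ {a = a} {b} _ _) = eq↓A σ a b
  projA (σ , _) (mixed-≤ {L = L} {c} m)    = ineq↓A σ L c m

  projB : ∀ ℓ → Projectable (atomOf ℓ) → Formula
  projB ℓ       (a-local _)                = ⊤ᶠ
  projB ℓ       (b-local _)                = literal ℓ
  projB ℓ       (shared _)                 = literal ℓ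
  projB (σ , _) (mixed-≈ {a = a} {b} _ _)  = eq↓B σ a b
  projB (σ , _) (mixed-≈˘ {a = a} {b} _ _) = eq↓B σ a b
  projB (σ , _) (mixed-≤ {L = L} {c} m)    = ineq↓B σ L c m

  auxVars : ∀ ℓ → Projectable (atomOf ℓ) → List Symbol
  auxVars (σ      , _) (mixed-≤ {L = L} {c} m)    = auxSymbol (ineq σ L c) ∷ []
  auxVars (Sign.+ , _) (mixed-≈ {a = a} {b} _ _)  = auxSymbol (eq a b) ∷ []
  auxVars (Sign.- , _) (mixed-≈ {a = a} {b} _ _)  =
    auxSymbol (eq a b) ∷ auxSymbol (bool a b) ∷ []
  auxVars (Sign.+ , _) (mixed-≈˘ {a = a} {b} _ _) = auxSymbol (eq a b) ∷ []
  auxVars (Sign.- , _) (mixed-≈˘ {a = a} {b} _ _) =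
    auxSymbol (eq a b) ∷ auxSymbol (bool a b) ∷ []
  auxVars _            (a-local _)                = []
  auxVars _            (b-local _)                = []
  auxVars _            (shared _)                 = []

  ¬projA ¬projB : ∀ {C} → ProjectableClause C → Formula
  ¬projA []                = ⊤ᶠ
  ¬projA (_∷_ {x = ℓ} π K) = projA (negate ℓ) π ∧ ¬projA K
  ¬projB []                = ⊤ᶠ
  ¬projB (_∷_ {x = ℓ} π K) = projB (negate ℓ) π ∧ ¬projB K

  ¬auxVars : ∀ {C} → ProjectableClause C → List Symbol
  ¬auxVars []                = []
  ¬auxVars (_∷_ {x = ℓ} π K) = auxVars (negate ℓ) π ++ ¬auxVars K

  -- The vocabulary condition also covers the symbols of s in LA(s, k, F), even
  -- those that do not occur in F: resolving puts s into the new formula.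
  record PartialInterpolant {C : Clause} (K : ProjectableClause C)
                            (I : LAFormula) : Set₁ where
    field
      implied      : (A ∧ ¬projA K) ⊨ formulaLA I
      inconsistent : (B ∧ ¬projB K ∧ formulaLA I) ⊨ ⊥ᶠ
      vocabulary   : ∀ {z} → z ∈ symbLA I → SharedSymbol z ⊎ z ∈ ¬auxVars K
      patterns     : ∀ {P} → P ∈ leaves I → WellFormed P
      only-in-LA   : ∀ {z} → z ∈ symbLits I → ¬ IneqAux z

  Fresh : Clause → Set
  Fresh C = ∀ κ → auxSymbol κ ∉ symb A × auxSymbol κ ∉ symb B
                × auxSymbol κ ∉ symbClause C

s₃ : ∀ {τ} → Pos τ → Pos τ → LATerm τ → LATerm τ → LATerm τ
s₃ c₁ c₂ s₁ s₂ = (c₂ *ᴾ s₁) +ᴾ (c₁ *ᴾ s₂)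

k₃ : ∀ {τ} → Pos τ → Pos τ → Slack τ → Slack τ → Slack τ
k₃ {int} c₁ c₂ k₁      k₂ =
  val c₂ ℤ.* k₁ ℤ.+ val c₁ ℤ.* k₂ ℤ.+ val c₁ ℤ.* val c₂
k₃ {rat} c₁ c₂ minus-ε k₂ = k₂
k₃ {rat} c₁ c₂ zero    k₂ = zero

⌈_/_⌉ : ℤ → (n : ℕ) .{{_ : NonZero n}} → ℤ
⌈ m / n ⌉ = ℤ.- ((ℤ.- m) ℤ./ℕ n)

-- For integers the upper index ⌈(k₁ + 1) / c₁⌉ is non-negative as k₁ ≥ -1.
F₃ : ∀ {τ} → Pos τ → Pos τ → LATerm τ → LATerm τ → Slack τ →
     (x₁ x₂ : ℕ) → Body → Body → Body
F₃ {int} (c₁ , c₁≢0) c₂ s₁ s₂ k₁ x₁ x₂ F₁ F₂ =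
  ⋁ (map disjunct (upTo (suc ℤ.∣ ⌈ k₁ ℤ.+ 1ℤ / c₁ ⌉ {{c₁≢0}} ∣)))
  where
  ⌊-s₁/c₁⌋ : Term (num int)
  ⌊-s₁/c₁⌋ = ⌊ lin (-ˡ linLA s₁) / c₁ ⌋ {{c₁≢0}}
  disjunct : ℕ → Body
  disjunct i =
    (F₁ ⟨ x₁ ∶ int ≔ lin ((1ℤ , ⌊-s₁/c₁⌋) ∷ (-1ℤ , const (+ i)) ∷ []) ⟩) ∧ⁿ
    (F₂ ⟨ x₂ ∶ int ≔ lin ((1ℤ , const (+ i)) ∷ (-1ℤ , ⌊-s₁/c₁⌋) ∷ []) ⟩)
F₃ {rat} (c₁ , c₁>0) c₂ s₁ s₂ k₁ x₁ x₂ F₁ F₂ = F k₁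
  where
  1/c₁ : ℚ
  1/c₁ = (1/ c₁) {{pos⇒nonZero c₁ {{c₁>0}}}}
  s₁/c₁ -s₁/c₁ : Term (num rat)
  s₁/c₁  = lin (1/c₁ · linLA s₁)
  -s₁/c₁ = lin (-ˡ (1/c₁ · linLA s₁))
  F : Slackℚ → Body
  F minus-ε = F₂ ⟨ x₂ ∶ rat ≔ s₁/c₁ ⟩
  F zero    = lit (Sign.+ , (linLA (s₃ (c₁ , c₁>0) c₂ s₁ s₂) ≤ (0ℚ -ε))) ∨ⁿ
              ((F₁ ⟨ x₁ ∶ rat ≔ -s₁/c₁ ⟩) ∧ⁿ (F₂ ⟨ x₂ ∶ rat ≔ s₁/c₁ ⟩))

{-# OPTIONS --safe #-}
module Submission where

-- Let x₂ and x₁ be the auxiliary variables of the pivot a + b ≤ c and of its negation.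
-- The heart of the matter is the equivalence
--
--   F₃(x⃗)  ⇔  F₁(v, x⃗) and F₂(-v, x⃗) for some value v                        (*)
--
-- which says that F₃ eliminates the two variables under the constraint x₂ = -x₁
-- (witness⇒F₃ and F₃⇒witness).  It uses only that the set of values v satisfying F₁
-- is closed downwards, contains no v with c₁ v + s₁ > 0 and contains every v with
-- c₁ v + s₁ < -k₁, and likewise for F₂; this is the notion of Profile.
--
-- Rationals: F₁(v) forces v ≤ -s₁/c₁, that is s₁/c₁ ≤ -v.  If k₁ = -ε then
-- F₁(-s₁/c₁) holds, so that v = -s₁/c₁ is the best choice.  If k₁ = 0 then either
-- v = -s₁/c₁, or v is smaller and s₃ < 0 follows; conversely s₃ < 0 leaves an open
-- interval of values between s₂/c₂ and -s₁/c₁ for v.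
--
-- Integers: with t = ⌊-s₁/c₁⌋, F₁(v) forces v = t - i for some i ≥ 0.  If i exceeds
-- N = ⌈(k₁ + 1)/c₁⌉, then t - N serves as well as v: there c₁ (t - N) + s₁ < -k₁, so
-- that F₁ holds, and F₂(N - t) follows from F₂(-v) by monotonicity.  Hence the
-- disjuncts for i = 0, …, N suffice.
--
-- By (*) monotonicity of F₃ is inherited, and F₃ = ⊥ for s₃ > 0, because s₃ is the
-- sum of c₂ (c₁ v + s₁) and c₁ (c₂ (-v) + s₂).  If s₃ < -k₃, there is enough room
-- for a value v with c₁ v + s₁ < -k₁ and c₂ (-v) + s₂ < -k₂, which gives F₃ = ⊤.
-- This is resolvent-wellFormed.
--
-- For the interpolation conditions, let M be a structure.
--
-- If M satisfies A and the A-projections, set x₁ to the value v of a and x₂ to -v.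
-- This affects neither A nor the projections of the other literals, and both
-- projections of the pivot hold.  So the premises hold after the change, and as
-- the holes occur positively (fill-mono), (*) turns F₁(v) and F₂(-v) into F₃.
--
-- If M satisfies B, the B-projections and I₁[I₂[F₃]], consider the two premises with
-- x₁ = v and x₂ = -v.  The projection of the pivot is v + b > c in the first and
-- v + b ≤ c in the second.  Every v with v + b > c refutes I₁[F₁(v)] and every v with
-- v + b ≤ c refutes I₂[F₂(-v)].  A large v shows that I₂[F₃] cannot be false, a small
-- v that F₃ cannot be false.  So F₃ holds, and for v as in (*) whichever of v + b > c
-- and v + b ≤ c is the case gives a contradiction.

open import Data.Bool.Base using (T)
open import Data.Empty using (⊥; ⊥-elim)
open import Data.Integer.Base as ℤ using (ℤ; +_; 0ℤ; 1ℤ; -1ℤ; ∣_∣)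
open import Data.List.Base using (List; []; _∷_; _++_; map; upTo)
open import Data.List.Membership.Propositional using (_∈_; _∉_; find; lose)
open import Data.List.Membership.Propositional.Properties
  using (∈-++⁺ˡ; ∈-++⁺ʳ; ∈-++⁻; ∈-map⁺; ∈-map⁻; ∈-concatMap⁺; ∈-concatMap⁻; ∈-upTo⁺)
open import Data.List.Relation.Ternary.Interleaving.Propositional
  using (Interleaving; consˡ; consʳ)
open import Data.List.Relation.Unary.All as All using (All; []; _∷_)
open import Data.List.Relation.Unary.All.Properties using (++⁺)
open import Data.List.Relation.Unary.Any using (here; there)
open import Data.Maybe.Base using (just; nothing; maybe)
open import Data.Nat.Base as ℕ using (ℕ; suc; NonZero)
open import Data.Product using (_×_; _,_; ∃; proj₁; proj₂)
open import Data.Rational.Base as ℚ using (ℚ; 0ℚ; 1ℚ; 1/_)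
open import Data.Rational.Solver using (module +-*-Solver)
open import Data.Sign.Base as Sign using (Sign; opposite)
open import Data.Sum as Sum using (_⊎_; inj₁; inj₂)
open import Data.Unit using (⊤; tt)
open import Function.Base using (_∘_; id; case_of_)
open import Relation.Binary.Definitions using (tri<; tri≈; tri>)
open import Relation.Binary.PropositionalEquality
  using (_≡_; _≢_; refl; cong; cong₂; subst; subst₂; sym; trans; module ≡-Reasoning)
open import Relation.Nullary using (¬_; Dec; yes; no; contradiction)
import Algebra.Properties.Ring as RingProperties
import Data.Integer.Base
import Data.Integer.DivMod as ℤ
import Data.Integer.Properties as ℤ
import Data.Integer.Tactic.RingSolver as ℤ-Solver
import Data.List.Membership.DecPropositional as DecMembership
import Data.List.Properties as List
import Data.Nat.Properties as ℕ
import Data.Rational.Base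
import Data.Rational.Properties as ℚ

-- Integer and rational arithmetic

module Arithmetic where

  open import Defs using
    ( Num; int; rat; Val; 0ᵛ; 1ᵛ; _+ᵛ_; _*ᵛ_; -ᵛ_; _≤ᵛ_; _<ᵛ_
    ; Bound; exact; _-ε; _≤ᵇ_; 0ᵇ; Pos; val; _*⁺_; Slack; Slackℚ; zero; minus-ε; _<-_; ⌈_/_⌉ )

  private variable
    τ : Num

  +ᵛ-assoc : ∀ (u v w : Val τ) → (u +ᵛ v) +ᵛ w ≡ u +ᵛ (v +ᵛ w)
  +ᵛ-assoc {int} = ℤ.+-assoc
  +ᵛ-assoc {rat} = ℚ.+-assoc

  +ᵛ-comm : ∀ (u v : Val τ) → u +ᵛ v ≡ v +ᵛ u
  +ᵛ-comm {int} = ℤ.+-comm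
  +ᵛ-comm {rat} = ℚ.+-comm

  +ᵛ-identityˡ : ∀ (v : Val τ) → 0ᵛ +ᵛ v ≡ v
  +ᵛ-identityˡ {int} = ℤ.+-identityˡ
  +ᵛ-identityˡ {rat} = ℚ.+-identityˡ

  +ᵛ-identityʳ : ∀ (v : Val τ) → v +ᵛ 0ᵛ ≡ v
  +ᵛ-identityʳ v = trans (+ᵛ-comm v 0ᵛ) (+ᵛ-identityˡ v)

  *ᵛ-assoc : ∀ (u v w : Val τ) → (u *ᵛ v) *ᵛ w ≡ u *ᵛ (v *ᵛ w)
  *ᵛ-assoc {int} = ℤ.*-assoc
  *ᵛ-assoc {rat} = ℚ.*-assoc

  *ᵛ-zeroʳ : ∀ (v : Val τ) → v *ᵛ 0ᵛ ≡ 0ᵛ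
  *ᵛ-zeroʳ {int} = ℤ.*-zeroʳ
  *ᵛ-zeroʳ {rat} = ℚ.*-zeroʳ

  *ᵛ-identityˡ : ∀ (v : Val τ) → 1ᵛ *ᵛ v ≡ v
  *ᵛ-identityˡ {int} = ℤ.*-identityˡ
  *ᵛ-identityˡ {rat} = ℚ.*-identityˡ

  *ᵛ-distribˡ : ∀ (u v w : Val τ) → u *ᵛ (v +ᵛ w) ≡ (u *ᵛ v) +ᵛ (u *ᵛ w)
  *ᵛ-distribˡ {int} = ℤ.*-distribˡ-+
  *ᵛ-distribˡ {rat} = ℚ.*-distribˡ-+

  -1*ᵛ : ∀ (v : Val τ) → (-ᵛ 1ᵛ) *ᵛ v ≡ -ᵛ v
  -1*ᵛ {int} = ℤ.-1*i≡-i
  -1*ᵛ {rat} v = trans (sym (ℚ.neg-distribˡ-* 1ᵛ v)) (cong ℚ.-_ (ℚ.*-identityˡ v))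

  -ᵛ-involutive : ∀ (v : Val τ) → -ᵛ (-ᵛ v) ≡ v
  -ᵛ-involutive {int} = ℤ.neg-involutive
  -ᵛ-involutive {rat} = RingProperties.-‿involutive ℚ.+-*-ring

  -ᵛ-inverseˡ : ∀ (v : Val τ) → (-ᵛ v) +ᵛ v ≡ 0ᵛ
  -ᵛ-inverseˡ {int} = ℤ.+-inverseˡ
  -ᵛ-inverseˡ {rat} = ℚ.+-inverseˡ

  ≤ᵛ-refl : ∀ {v : Val τ} → v ≤ᵛ v
  ≤ᵛ-refl {int} = ℤ.≤-refl
  ≤ᵛ-refl {rat} = ℚ.≤-refl

  val-*⁺ : ∀ (c d : Pos τ) → val (c *⁺ d) ≡ val c *ᵛ val d
  val-*⁺ {int} (m , _) (n , _) = ℤ.pos-* m n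
  val-*⁺ {rat} c d = refl

  0≤ᵇ0 : ∀ {τ} → _≤ᵇ_ {τ} 0ᵛ 0ᵇ
  0≤ᵇ0 {int} = ℤ.≤-refl
  0≤ᵇ0 {rat} = ℚ.≤-refl

  _≤ᵇ?_ : ∀ {τ} (v : Val τ) (c : Bound τ) → Dec (v ≤ᵇ c)
  _≤ᵇ?_ {int} v c         = v ℤ.≤? c
  _≤ᵇ?_ {rat} v (exact q) = v ℚ.≤? q
  _≤ᵇ?_ {rat} v (q -ε)    = v ℚ.<? q

  ∃-≤ᵇ : ∀ {τ} (b : Val τ) (c : Bound τ) → ∃ λ (v : Val τ) → (v +ᵛ b) ≤ᵇ c
  ∃-≤ᵇ {int} b c = c ℤ.- b , ℤ.≤-reflexive (ring c b)
    where
    ring : ∀ c b → c ℤ.- b ℤ.+ b ≡ c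
    ring = ℤ-Solver.solve-∀
  ∃-≤ᵇ {rat} b (exact q) = q ℚ.- b , ℚ.≤-reflexive (solve 2 (λ q b → q :- b :+ b := q) refl q b)
    where open +-*-Solver
  ∃-≤ᵇ {rat} b (q -ε) = p ℚ.- b , subst (ℚ._< q) (solve 2 (λ p b → p := p :- b :+ b) refl p b) p<q
    where
    open +-*-Solver
    p = q ℚ.- 1ℚ
    p<q : p ℚ.< q
    p<q = subst (p ℚ.<_) (ℚ.+-identityʳ q) (ℚ.+-monoʳ-< q (ℚ.negative⁻¹ (ℚ.- 1ℚ)))

  ∃-≰ᵇ : ∀ {τ} (b : Val τ) (c : Bound τ) → ∃ λ (v : Val τ) → ¬ ((v +ᵛ b) ≤ᵇ c)
  ∃-≰ᵇ {int} b c = ℤ.suc c ℤ.- b , λ v≤c →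
    ℤ.<-irrefl refl (ℤ.suc[i]≤j⇒i<j (subst (ℤ._≤ c) (ring (ℤ.suc c) b) v≤c))
    where
    ring : ∀ d b → d ℤ.- b ℤ.+ b ≡ d
    ring = ℤ-Solver.solve-∀
  ∃-≰ᵇ {rat} b (q -ε) = q ℚ.- b , ℚ.<-irrefl (solve 2 (λ q b → q :- b :+ b := q) refl q b)
    where open +-*-Solver
  ∃-≰ᵇ {rat} b (exact q) = p ℚ.- b , λ p≤q → ℚ.<-irrefl refl (ℚ.<-≤-trans q<p
      (subst (ℚ._≤ q) (solve 2 (λ p b → p :- b :+ b := p) refl p b) p≤q))
    where
    open +-*-Solver
    p = q ℚ.+ 1ℚ
    q<p : q ℚ.< p
    q<p = subst (ℚ._< p) (ℚ.+-identityʳ q) (ℚ.+-monoʳ-< q (ℚ.positive⁻¹ 1ℚ))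

  -- What well-formedness of LA(c · x + s, k, F) says about the set P of the values
  -- v for which F holds at x = v, where S is the value of s.
  record Profile {τ} (c : Pos τ) (S : Val τ) (k : Slack τ) (P : Val τ → Set) : Set where
    field
      closed-≤ : ∀ {v w} → w ≤ᵛ v → P v → P w
      bounded  : ∀ {v} → P v → ¬ (0ᵛ <ᵛ val c *ᵛ v +ᵛ S)
      holds    : ∀ {v} → (val c *ᵛ v +ᵛ S) <- k → P v

  open Profile

  module _ where
    open ℤ-Solver using (solve-∀)
    open Data.Integer.Base using (_+_; _*_; -_; _-_; _≤_; _<_; _/ℕ_)

    -- An inequality is proved by writing its gap as a sum of products of
    -- non-negative numbers; the equation is left to the ring solver.
    private
      by : ∀ {d i j} → 0ℤ ≤ d → d ≡ j - i → i ≤ j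
      by 0≤d refl = ℤ.0≤i-j⇒j≤i 0≤d

      gap : ∀ {i j} → i ≤ j → 0ℤ ≤ j - i
      gap = ℤ.i≤j⇒0≤j-i

      _⊕_ : ∀ {i j} → 0ℤ ≤ i → 0ℤ ≤ j → 0ℤ ≤ i + j
      _⊕_ = ℤ.+-mono-≤

      _⊛_ : ∀ n {j} → 0ℤ ≤ j → 0ℤ ≤ + n * j
      _⊛_ n {j} 0≤j = subst (_≤ + n * j) (ℤ.*-zeroʳ (+ n)) (ℤ.*-monoˡ-≤-nonNeg (+ n) 0≤j)

      0≤+ : ∀ n → 0ℤ ≤ + n
      0≤+ n = ℤ.+≤+ ℕ.z≤n

    ⌈/⌉-upper : ∀ m n .{{_ : NonZero n}} → m ≤ ⌈ m / n ⌉ * + n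
    ⌈/⌉-upper m n = by (gap (ℤ.[n/ℕd]*d≤n (- m) n)) (ring m ((- m) /ℕ n) (+ n))
      where
      ring : ∀ m q n → - m - q * n ≡ - q * n - m
      ring = solve-∀

    0≤⌈/⌉ : ∀ m n .{{_ : NonZero n}} → 0ℤ ≤ m → 0ℤ ≤ ⌈ m / n ⌉
    0≤⌈/⌉ m n@(suc _) 0≤m = ℤ.*-cancelʳ-≤-pos 0ℤ ⌈ m / n ⌉ (+ n)
      (ℤ.≤-trans 0≤m (⌈/⌉-upper m n))

    ≤⌊/⌋ : ∀ v m n .{{_ : NonZero n}} → + n * v ≤ m → v ≤ m /ℕ n
    ≤⌊/⌋ v m n nv≤m = ℤ.≤-trans (ℤ.i<j⇒i≤pred[j] v<1+q) (ℤ.≤-reflexive (ℤ.pred-suc _))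
      where
      v<1+q : v < ℤ.suc (m /ℕ n)
      v<1+q = ℤ.*-cancelʳ-<-nonNeg (+ n)
        (ℤ.≤-<-trans (ℤ.≤-trans (ℤ.≤-reflexive (ℤ.*-comm v (+ n))) nv≤m) (ℤ.n<s[n/ℕd]*d m n))

    -- The gap contains the product of n₁ - 1 and n₂ - 1.
    combined-slack : ∀ n₁ n₂ .{{_ : NonZero n₁}} .{{_ : NonZero n₂}} {k₁ k₂} →
                     -1ℤ ≤ k₁ → -1ℤ ≤ k₂ → -1ℤ ≤ + n₂ * k₁ + + n₁ * k₂ + + n₁ * + n₂
    combined-slack n₁ n₂ {k₁} {k₂} -1≤k₁ -1≤k₂ =
      by (((n₂ ⊛ gap -1≤k₁) ⊕ (n₁ ⊛ gap -1≤k₂)) ⊕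
          subst (0ℤ ≤_) (cong₂ _*_ (pred+ n₁) (pred+ n₂)) (ℕ.pred n₁ ⊛ 0≤+ (ℕ.pred n₂)))
         (ring (+ n₁) (+ n₂) k₁ k₂)
      where
      pred+ : ∀ n .{{_ : NonZero n}} → + ℕ.pred n ≡ + n - 1ℤ
      pred+ (suc n) = sym (ℤ.m-n≡m⊖n (suc n) 1)
      ring : ∀ c₁ c₂ k₁ k₂ →
             c₂ * (k₁ - -1ℤ) + c₁ * (k₂ - -1ℤ) + (c₁ - 1ℤ) * (c₂ - 1ℤ) ≡
             (c₂ * k₁ + c₁ * k₂ + c₁ * c₂) - -1ℤ
      ring = solve-∀

    module Resolveℤ {c₁ c₂ : Pos int} {S₁ S₂ k₁ k₂ : ℤ} {P Q : ℤ → Set}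
                    (p : Profile c₁ S₁ k₁ P) (q : Profile c₂ S₂ k₂ Q) where
      private
        n₁ = proj₁ c₁
        n₂ = proj₁ c₂
        instance
          n₁≢0 : NonZero n₁
          n₁≢0 = proj₂ c₁

        t : ℤ
        t = (- S₁) /ℕ n₁

        upper₁ : ∀ {v} → P v → + n₁ * v + S₁ ≤ 0ℤ
        upper₁ Pv = ℤ.≮⇒≥ (bounded p Pv)

        upper₂ : ∀ {v} → Q v → + n₂ * v + S₂ ≤ 0ℤ
        upper₂ Qv = ℤ.≮⇒≥ (bounded q Qv)

        v≤t : ∀ {v} → P v → v ≤ t
        v≤t {v} Pv = ≤⌊/⌋ v (- S₁) n₁ (by (gap (upper₁ Pv)) (ring (+ n₁) v S₁))
          where
          ring : ∀ c v s → 0ℤ - (c * v + s) ≡ - s - c * v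
          ring = solve-∀

      -- A witness v = t - i with i beyond the largest index N is replaced by t - N: there
      -- P holds because c₁ (t - N) + S₁ < -k₁, and Q holds as N - t ≤ -v.
      witness⇒index : -1ℤ ≤ k₁ → ∀ {v} → P v → Q (- v) →
        ∃ λ i → i ℕ.< suc ∣ ⌈ k₁ + 1ℤ / n₁ ⌉ ∣ × P (t - + i) × Q (+ i - t)
      witness⇒index -1≤k₁ {v} Pv Qv with ∣ t - v ∣ ℕ.≤? ∣ ⌈ k₁ + 1ℤ / n₁ ⌉ ∣
      ... | yes i≤N = ∣ t - v ∣ , ℕ.s≤s i≤N , subst P (sym t-i≡v) Pv , subst Q (sym i-t≡-v) Qv
        where
        i≡t-v : + ∣ t - v ∣ ≡ t - v
        i≡t-v = ℤ.0≤i⇒+∣i∣≡i (gap (v≤t Pv))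
        t-i≡v : t - + ∣ t - v ∣ ≡ v
        t-i≡v = trans (cong (λ i → t - i) i≡t-v) (ring t v)
          where
          ring : ∀ t v → t - (t - v) ≡ v
          ring = solve-∀
        i-t≡-v : + ∣ t - v ∣ - t ≡ - v
        i-t≡-v = trans (cong (_- t) i≡t-v) (ring t v)
          where
          ring : ∀ t v → t - v - t ≡ - v
          ring = solve-∀
      ... | no i≰N = ∣ N ∣ , ℕ.≤-refl , holds p sum<-k₁ , closed-≤ q N-t≤-v Qv
        where
        N = ⌈ k₁ + 1ℤ / n₁ ⌉
        N≡ : + ∣ N ∣ ≡ N
        N≡ = ℤ.0≤i⇒+∣i∣≡i (0≤⌈/⌉ _ n₁ (ℤ.+-monoˡ-≤ 1ℤ -1≤k₁))
        sum<-k₁ : + n₁ * (t - + ∣ N ∣) + S₁ < - k₁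
        sum<-k₁ = subst (λ n → + n₁ * (t - n) + S₁ < - k₁) (sym N≡)
          (ℤ.suc[i]≤j⇒i<j (by (gap (ℤ.[n/ℕd]*d≤n (- S₁) n₁) ⊕ gap (⌈/⌉-upper (k₁ + 1ℤ) n₁))
                              (ring t (+ n₁) S₁ N k₁)))
          where
          ring : ∀ t c s n k →
                 (- s - t * c) + (n * c - (k + 1ℤ)) ≡ - k - (1ℤ + (c * (t - n) + s))
          ring = solve-∀
        N-t≤-v : + ∣ N ∣ - t ≤ - v
        N-t≤-v = by (gap (ℤ.≤-trans (ℤ.+≤+ (ℕ.<⇒≤ (ℕ.≰⇒> i≰N)))
                                    (ℤ.≤-reflexive (ℤ.0≤i⇒+∣i∣≡i (gap (v≤t Pv))))))
                    (ring t v (+ ∣ N ∣))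
          where
          ring : ∀ t v n → t - v - n ≡ - v - (n - t)
          ring = solve-∀

      index⇒witness : ∀ i → P (t - + i) → Q (+ i - t) → ∃ λ v → P v × Q (- v)
      index⇒witness i Pi Qi = t - + i , Pi , subst Q (ring t (+ i)) Qi
        where
        ring : ∀ t i → i - t ≡ - (t - i)
        ring = solve-∀

      combined-≤0 : ∀ {v} → P v → Q (- v) → ¬ (0ℤ < + n₂ * S₁ + + n₁ * S₂)
      combined-≤0 {v} Pv Qv = ℤ.≤⇒≯
        (by ((n₂ ⊛ gap (upper₁ Pv)) ⊕ (n₁ ⊛ gap (upper₂ Qv))) (ring (+ n₁) (+ n₂) v S₁ S₂))
        where
        ring : ∀ c₁ c₂ v s₁ s₂ →
               c₂ * (0ℤ - (c₁ * v + s₁)) + c₁ * (0ℤ - (c₂ * - v + s₂)) ≡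
               0ℤ - (c₂ * s₁ + c₁ * s₂)
        ring = solve-∀

      -- The witness is the largest v with c₁ v + S₁ < -k₁.  Then c₁ (v + 1) + S₁ ≥ -k₁,
      -- so that c₁ (c₂ (-v) + S₂) ≤ c₂ S₁ + c₁ S₂ + c₂ k₁ + c₁ c₂ < -c₁ k₂; this is what
      -- the summand c₁ c₂ of k₃ is for.
      combined-< : + n₂ * S₁ + + n₁ * S₂ < - (+ n₂ * k₁ + + n₁ * k₂ + + n₁ * + n₂) →
                   ∃ λ v → P v × Q (- v)
      combined-< s₃<-k₃ = v , holds p first , holds q second
        where
        m = - k₁ - 1ℤ - S₁
        v = m /ℕ n₁
        first : + n₁ * v + S₁ < - k₁
        first = ℤ.suc[i]≤j⇒i<j (by (gap (ℤ.[n/ℕd]*d≤n m n₁)) (ring v (+ n₁) k₁ S₁))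
          where
          ring : ∀ v c k s → (- k - 1ℤ - s) - v * c ≡ - k - (1ℤ + (c * v + s))
          ring = solve-∀
        second : + n₂ * - v + S₂ < - k₂
        second = ℤ.*-cancelˡ-<-nonNeg (+ n₁) (ℤ.suc[i]≤j⇒i<j
          (by (gap (ℤ.i<j⇒suc[i]≤j s₃<-k₃) ⊕ (n₂ ⊛ gap (ℤ.i<j⇒suc[i]≤j (ℤ.n<s[n/ℕd]*d m n₁))))
              (ring v (+ n₁) (+ n₂) k₁ k₂ S₁ S₂)))
          where
          ring : ∀ v c₁ c₂ k₁ k₂ s₁ s₂ →
                 (- (c₂ * k₁ + c₁ * k₂ + c₁ * c₂) - (1ℤ + (c₂ * s₁ + c₁ * s₂))) +
                 c₂ * ((1ℤ + v) * c₁ - (1ℤ + (- k₁ - 1ℤ - s₁))) ≡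
                 c₁ * - k₂ - (1ℤ + c₁ * (c₂ * - v + s₂))
          ring = solve-∀

  module _ where
    open +-*-Solver using (solve; _:=_; _:+_; _:*_; _:-_; :-_)
    open Data.Rational.Base using (_+_; _*_; -_; _-_; _≤_; _<_)

    private
      module Scale (c : ℚ) .{{c>0 : ℚ.Positive c}} where
        instance
          c≥0 : ℚ.NonNegative c
          c≥0 = ℚ.pos⇒nonNeg c

        scale-≤ : ∀ {p} → p ≤ 0ℚ → c * p ≤ 0ℚ
        scale-≤ p≤0 = ℚ.≤-trans (ℚ.*-monoˡ-≤-nonNeg c p≤0) (ℚ.≤-reflexive (ℚ.*-zeroʳ c))

        scale-< : ∀ {p} → p < 0ℚ → c * p < 0ℚ
        scale-< p<0 = ℚ.<-≤-trans (ℚ.*-monoʳ-<-pos c p<0) (ℚ.≤-reflexive (ℚ.*-zeroʳ c))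

        unscale-≤ : ∀ {p} → c * p ≤ 0ℚ → p ≤ 0ℚ
        unscale-≤ cp≤0 = ℚ.*-cancelˡ-≤-pos c (ℚ.≤-trans cp≤0 (ℚ.≤-reflexive (sym (ℚ.*-zeroʳ c))))

        unscale-< : ∀ {p} → c * p < 0ℚ → p < 0ℚ
        unscale-< cp<0 =
          ℚ.*-cancelˡ-<-nonNeg c (ℚ.<-≤-trans cp<0 (ℚ.≤-reflexive (sym (ℚ.*-zeroʳ c))))

      ≤⇒≯ : ∀ {p q} → p ≤ q → ¬ q < p
      ≤⇒≯ p≤q q<p = ℚ.<-irrefl refl (ℚ.<-≤-trans q<p p≤q)

      p-q≤0⇒p≤q : ∀ {p q} → p - q ≤ 0ℚ → p ≤ q
      p-q≤0⇒p≤q {p} {q} p-q≤0 = subst (_≤ q)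
        (solve 2 (λ p q → p :- q :+ q := p) refl p q)
        (ℚ.≤-trans (ℚ.+-monoˡ-≤ q p-q≤0) (ℚ.≤-reflexive (ℚ.+-identityˡ q)))

      p-q<0⇒p<q : ∀ {p q} → p - q < 0ℚ → p < q
      p-q<0⇒p<q {p} {q} p-q<0 = subst (_< q)
        (solve 2 (λ p q → p :- q :+ q := p) refl p q)
        (ℚ.<-≤-trans (ℚ.+-monoˡ-< q p-q<0) (ℚ.≤-reflexive (ℚ.+-identityˡ q)))

      p<q⇒p-q<0 : ∀ {p q} → p < q → p - q < 0ℚ
      p<q⇒p-q<0 {p} {q} p<q =
        ℚ.<-≤-trans (ℚ.+-monoˡ-< (- q) p<q) (ℚ.≤-reflexive (ℚ.+-inverseʳ q))

    -- The reciprocal, spelled so that it is definitionally the one that occurs in F₃.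
    1/⁺ : Pos rat → ℚ
    1/⁺ (c , c>0) = (1/ c) {{ℚ.pos⇒nonZero c {{c>0}}}}

    *-1/⁺-cancel : ∀ (c : Pos rat) p → proj₁ c * (1/⁺ c * p) ≡ p
    *-1/⁺-cancel (c , c>0) p = trans (sym (ℚ.*-assoc c (1/⁺ (c , c>0)) p))
      (trans (cong (_* p) (ℚ.*-inverseʳ c {{ℚ.pos⇒nonZero c {{c>0}}}})) (ℚ.*-identityˡ p))

    <0⇒<- : ∀ {p} k → p < 0ℚ → _<-_ {rat} p k
    <0⇒<- zero    p<0 = p<0
    <0⇒<- minus-ε p<0 = ℚ.<⇒≤ p<0

    -- Here w stands for S₁ / c₁, the value that F₃ substitutes for x₂.
    module Resolveℚ {c₁ c₂ : Pos rat} {S₁ S₂ w : ℚ} {k₁ k₂ : Slackℚ} {P Q : ℚ → Set}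
                    (c₁w≡S₁ : proj₁ c₁ * w ≡ S₁)
                    (p : Profile c₁ S₁ k₁ P) (q : Profile c₂ S₂ k₂ Q) where
      private
        d₁ = proj₁ c₁
        d₂ = proj₁ c₂
        instance
          d₁>0 : ℚ.Positive d₁
          d₁>0 = proj₂ c₁
          d₂>0 : ℚ.Positive d₂
          d₂>0 = proj₂ c₂
        module D₁ = Scale d₁
        module D₂ = Scale d₂

        s₃≡ : d₁ * (d₂ * w + S₂) ≡ d₂ * S₁ + d₁ * S₂
        s₃≡ = subst (λ s → d₁ * (d₂ * w + S₂) ≡ d₂ * s + d₁ * S₂) c₁w≡S₁
          (solve 4 (λ a b w s → a :* (b :* w :+ s) := b :* (a :* w) :+ a :* s) refl d₁ d₂ w S₂)

        sum₁≡ : ∀ v → d₁ * (v + w) ≡ d₁ * v + S₁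
        sum₁≡ v = trans (ℚ.*-distribˡ-+ d₁ v w) (cong (λ s → d₁ * v + s) c₁w≡S₁)

        upper₁ : ∀ {v} → P v → v + w ≤ 0ℚ
        upper₁ {v} Pv = D₁.unscale-≤ (subst (_≤ 0ℚ) (sym (sum₁≡ v)) (ℚ.≮⇒≥ (bounded p Pv)))

        upper₂ : ∀ {v} → Q v → d₂ * v + S₂ ≤ 0ℚ
        upper₂ Qv = ℚ.≮⇒≥ (bounded q Qv)

        v+w≡w-[-v] : ∀ v → v + w ≡ w - (- v)
        v+w≡w-[-v] v = solve 2 (λ v w → v :+ w := w :- (:- v)) refl v w

      w≤-v : ∀ {v} → P v → w ≤ - v
      w≤-v {v} Pv = p-q≤0⇒p≤q (subst (_≤ 0ℚ) (v+w≡w-[-v] v) (upper₁ Pv))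

      quotient⇒witness : P (- w) → Q w → ∃ λ v → P v × Q (- v)
      quotient⇒witness P-w Qw = - w , P-w , subst Q (sym (-ᵛ-involutive {rat} w)) Qw

      sum-at-quotient : d₁ * - w + S₁ ≡ 0ℚ
      sum-at-quotient =
        trans (sym (sum₁≡ (- w))) (trans (cong (d₁ *_) (ℚ.+-inverseˡ w)) (ℚ.*-zeroʳ d₁))

      witness⇒strict-or-quotient : ∀ {v} → P v → Q (- v) →
        (d₂ * S₁ + d₁ * S₂ < 0ℚ) ⊎ (P (- w) × Q w)
      witness⇒strict-or-quotient {v} Pv Qv with ℚ.<-cmp w (- v)
      ... | tri< w<-v _ _ = inj₁ (subst (_< 0ℚ) s₃≡ (D₁.scale-< (ℚ.<-≤-trans
              (ℚ.+-monoˡ-< S₂ (ℚ.*-monoʳ-<-pos d₂ w<-v)) (upper₂ Qv))))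
      ... | tri≈ _ refl _ = inj₂ (subst P (sym (-ᵛ-involutive {rat} v)) Pv , Qv)
      ... | tri> _ _ -v<w = contradiction -v<w (≤⇒≯ (w≤-v Pv))

      -- The witness is -u for some u strictly between S₁ / c₁ and -S₂ / c₂, where both
      -- sums are negative.
      strict⇒witness : d₂ * S₁ + d₁ * S₂ < 0ℚ → ∃ λ v → P v × Q (- v)
      strict⇒witness s₃<0 =
        - u , holds p (<0⇒<- k₁ first) ,
        subst Q (sym (-ᵛ-involutive {rat} u)) (holds q (<0⇒<- k₂ second))
        where
        y = 1/⁺ c₂ * - S₂
        w<y : w < y
        w<y = p-q<0⇒p<q (D₂.unscale-< (subst (_< 0ℚ) eq
                (D₁.unscale-< (subst (_< 0ℚ) (sym s₃≡) s₃<0))))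
          where
          eq : d₂ * w + S₂ ≡ d₂ * (w - y)
          eq = trans (solve 3 (λ d w s → d :* w :+ s := d :* w :- (:- s)) refl d₂ w S₂)
               (trans (cong (λ r → d₂ * w - r) (sym (*-1/⁺-cancel c₂ (- S₂))))
                      (solve 3 (λ d w y → d :* w :- d :* y := d :* (w :- y)) refl d₂ w y))
        between = ℚ.<-dense w<y
        u = proj₁ between
        first : d₁ * - u + S₁ < 0ℚ
        first = subst (_< 0ℚ) (trans (cong (d₁ *_) (ℚ.+-comm w (- u))) (sum₁≡ (- u)))
          (D₁.scale-< (p<q⇒p-q<0 (proj₁ (proj₂ between))))
        second : d₂ * u + S₂ < 0ℚ
        second = subst (d₂ * u + S₂ <_) (ℚ.+-inverseˡ S₂) (ℚ.+-monoˡ-< S₂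
          (subst (d₂ * u <_) (*-1/⁺-cancel c₂ (- S₂)) (ℚ.*-monoʳ-<-pos d₂ (proj₂ (proj₂ between)))))

      combined-≤0 : ∀ {v} → P v → Q (- v) → ¬ (0ℚ < d₂ * S₁ + d₁ * S₂)
      combined-≤0 Pv Qv = ≤⇒≯ (subst (_≤ 0ℚ) s₃≡ (D₁.scale-≤ (ℚ.≤-trans
        (ℚ.+-monoˡ-≤ S₂ (ℚ.*-monoˡ-≤-nonNeg d₂ {{D₂.c≥0}} (w≤-v Pv))) (upper₂ Qv))))

      sum₂-<- : _<-_ {rat} (d₂ * S₁ + d₁ * S₂) k₂ → _<-_ {rat} (d₂ * w + S₂) k₂
      sum₂-<- = go k₂
        where
        go : ∀ k → _<-_ {rat} (d₂ * S₁ + d₁ * S₂) k → _<-_ {rat} (d₂ * w + S₂) k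
        go zero    s₃<0 = D₁.unscale-< (subst (_< 0ℚ) (sym s₃≡) s₃<0)
        go minus-ε s₃≤0 = D₁.unscale-≤ (subst (_≤ 0ℚ) (sym s₃≡) s₃≤0)

open import Defs
open Arithmetic

open DecMembership ℕ._≟_ using (_∈?_)

private variable
  τ : Num

∈-++-elim : ∀ {A C : Set} {z : A} xs {ys} → (z ∈ xs → C) → (z ∈ ys → C) → z ∈ xs ++ ys → C
∈-++-elim xs f g = Sum.[ f , g ]′ ∘ ∈-++⁻ xs

-- Reinterpreting the function symbols

-- Interpretations of the function symbols over given carriers.
Interpretation : (ℕ → Set) → Set
Interpretation Carrier =
  (f : ℕ) (ds : List Sort) (s : Sort) → All (SortVal Carrier) ds → SortVal Carrier s

InterpretationOf : Structure → Set
InterpretationOf M = Interpretation (Structure.Carrier M)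

-- M with its function symbols reinterpreted; carriers and predicates are kept, so
-- that values in different reinterpretations of M can be compared.
reinterpret : (M : Structure) → InterpretationOf M → Structure
reinterpret M g = record
  { Carrier = Carrier ; _≟_ = _≟_ ; funᴵ = g ; predᴵ = predᴵ }
  where open Structure M

-- The interpretations g and h agree at a symbol.  There is nothing to require of a
-- predicate symbol, as only function symbols are reinterpreted.
Agreement : (Carrier : ℕ → Set) (g h : Interpretation Carrier) → Symbol → Set
Agreement Carrier g h (fun f ds s) = ∀ vs → g f ds s vs ≡ h f ds s vs
Agreement Carrier g h (pred p ds)  = ⊤

-- Agreement over the carriers of M, which is all that matters of M.
AgreeAt : (M : Structure) (g h : InterpretationOf M) → Symbol → Set
AgreeAt M = Agreement (Structure.Carrier M)

agree-refl : ∀ M {g : InterpretationOf M} z → AgreeAt M g g z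
agree-refl M (fun f ds s) vs = refl
agree-refl M (pred p ds)     = tt

agree-sym : ∀ M {g h : InterpretationOf M} z → AgreeAt M g h z → AgreeAt M h g z
agree-sym M (fun f ds s) g≗h vs = sym (g≗h vs)
agree-sym M (pred p ds)  _      = tt

agree-trans : ∀ M {g h i : InterpretationOf M} z →
              AgreeAt M g h z → AgreeAt M h i z → AgreeAt M g i z
agree-trans M (fun f ds s) g≗h h≗i vs = trans (g≗h vs) (h≗i vs)
agree-trans M (pred p ds)  _   _      = tt

module Coincidence (M : Structure) (g h : InterpretationOf M) where

  private
    G = reinterpret M g
    H = reinterpret M h

  Agree : List Symbol → Set
  Agree zs = ∀ {z} → z ∈ zs → AgreeAt M g h z

  private
    left : ∀ {ys zs} → Agree (ys ++ zs) → Agree ys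
    left agree = agree ∘ ∈-++⁺ˡ

    right : ∀ ys {zs} → Agree (ys ++ zs) → Agree zs
    right ys agree = agree ∘ ∈-++⁺ʳ ys

  coincide-term  : ∀ {s} (t : Term s) → Agree (symbTerm t) → ⟦ G ⟧ t ≡ ⟦ H ⟧ t
  coincide-terms : ∀ {ds} (ts : All Term ds) → Agree (symbTerms ts) →
                   ⟦ G ⟧* ts ≡ ⟦ H ⟧* ts
  coincide-lin   : ∀ {τ} (L : Lin τ) → Agree (symbLin L) → ⟦ G ⟧ˡ L ≡ ⟦ H ⟧ˡ L

  coincide-term (app f ts) agree =
    trans (agree (here refl) _) (cong (h f _ _) (coincide-terms ts (agree ∘ there)))
  coincide-term (const c)  agree = refl
  coincide-term (lin L)    agree = coincide-lin L agree
  coincide-term ⌊ t / k ⌋  agree = cong (ℤ._/ℕ k) (coincide-term t agree)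

  coincide-terms []       agree = refl
  coincide-terms (t ∷ ts) agree =
    cong₂ _∷_ (coincide-term t (left agree)) (coincide-terms ts (right (symbTerm t) agree))

  coincide-lin []            agree = refl
  coincide-lin ((c , t) ∷ L) agree =
    cong₂ (λ v w → (c *ᵛ v) +ᵛ w)
      (coincide-term t (left agree)) (coincide-lin L (right (symbTerm t) agree))

  coincide-atom : ∀ α → Agree (symbAtom α) → ⟦ G ⟧ᵃ α ≡ ⟦ H ⟧ᵃ α
  coincide-atom (t ≈ u)     agree =
    cong₂ _≡_ (coincide-term t (left agree)) (coincide-term u (right (symbTerm t) agree))
  coincide-atom (L ≤ c)     agree = cong (_≤ᵇ c) (coincide-lin L agree)
  coincide-atom (pred p ts) agree =
    cong (λ vs → T (Structure.predᴵ M p _ vs)) (coincide-terms ts (agree ∘ there))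

  -- The truth value of a formula depends only on the symbols that occur in it.
  coincidence : ∀ φ → Agree (symb φ) → (G ⊨ᶠ φ) ≡ (H ⊨ᶠ φ)
  coincidence ⊤ᶠ       agree = refl
  coincidence ⊥ᶠ       agree = refl
  coincidence (atom α) agree = coincide-atom α agree
  coincidence (¬ᶠ φ)   agree = cong ¬_ (coincidence φ agree)
  coincidence (φ ∧ ψ)  agree =
    cong₂ _×_ (coincidence φ (left agree)) (coincidence ψ (right (symb φ) agree))
  coincidence (φ ∨ ψ)  agree =
    cong₂ _⊎_ (coincidence φ (left agree)) (coincidence ψ (right (symb φ) agree))

symb-literal : ∀ ℓ → symb (literal ℓ) ≡ symbLiteral ℓ
symb-literal (Sign.+ , α) = refl
symb-literal (Sign.- , α) = refl

symb-body : ∀ (F : Body) → symb (formulaBody F) ≡ symbLits F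
symb-body (lit ℓ)  = symb-literal ℓ
symb-body ⊤ⁿ       = refl
symb-body ⊥ⁿ       = refl
symb-body (F ∧ⁿ G) = cong₂ _++_ (symb-body F) (symb-body G)
symb-body (F ∨ⁿ G) = cong₂ _++_ (symb-body F) (symb-body G)

-- Assignments and substitution

infix 8 _[_∶_≔_]

-- M with the variable x of sort num τ reinterpreted as v.
_[_∶_≔_] : Structure → ℕ → (τ : Num) → Val τ → Structure
M [ x ∶ τ ≔ v ] = assign M τ (x ∷ []) (λ _ → v)

-- F holds at x = v.
Holds : Structure → ℕ → Body → Val τ → Set
Holds {τ} M x F v = M [ x ∶ τ ≔ v ] ⊨ᶠ formulaBody F

assign-here : ∀ M τ ys ρ {y} → y ∈ ys → ⟦ assign M τ ys ρ ⟧ {num τ} ⟨ y ⟩ ≡ ρ y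
assign-here M τ ys ρ {y} y∈ys with num τ ≟ˢ num τ | y ∈? ys
... | yes refl | yes _   = refl
... | yes refl | no y∉ys = contradiction y∈ys y∉ys
... | no τ≢τ   | _       = contradiction refl τ≢τ

-- An assignment agrees with h if it does so both inside and outside its domain.
assign-agree : ∀ M τ ys ρ (h : InterpretationOf M) z →
               (∀ {y} → y ∈ ys → z ≡ var (num τ) y → ρ y ≡ h y [] (num τ) []) →
               (z ∉ map (var (num τ)) ys → AgreeAt M (Structure.funᴵ M) h z) →
               AgreeAt M (Structure.funᴵ (assign M τ ys ρ)) h z
assign-agree M τ ys ρ h (pred p ds)        inside outside = tt
assign-agree M τ ys ρ h (fun f (d ∷ ds) s) inside outside =
  outside λ z∈ → case ∈-map⁻ (var (num τ)) z∈ of λ ()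
assign-agree M τ ys ρ h (fun f [] s)       inside outside [] with s ≟ˢ num τ | f ∈? ys
... | yes refl | yes f∈ys = inside f∈ys refl
... | yes refl | no f∉ys  = outside (λ z∈ → case ∈-map⁻ (var (num τ)) z∈ of
                                      λ { (_ , f∈ys , refl) → f∉ys f∈ys }) []
... | no s≢    | yes _    = outside (λ z∈ → case ∈-map⁻ (var (num τ)) z∈ of
                                      λ { (_ , _ , refl) → s≢ refl }) []
... | no s≢    | no _     = outside (λ z∈ → case ∈-map⁻ (var (num τ)) z∈ of
                                      λ { (_ , _ , refl) → s≢ refl }) []

assign-elsewhere : ∀ M τ ys ρ {z} → z ∉ map (var (num τ)) ys →
                   AgreeAt M (Structure.funᴵ (assign M τ ys ρ)) (Structure.funᴵ M) z
assign-elsewhere M τ ys ρ {z} z∉ = assign-agree M τ ys ρ (Structure.funᴵ M) z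
  (λ { y∈ys refl → contradiction (∈-map⁺ (var (num τ)) y∈ys) z∉ })
  (λ _ → agree-refl M z)

≢⇒∉[] : ∀ {A : Set} {x y : A} → x ≢ y → x ∉ y ∷ []
≢⇒∉[] x≢y (here x≡y) = x≢y x≡y

module Update (M : Structure) {τ : Num} (x : ℕ) (v : Val τ) where

  private
    module C = Coincidence M (Structure.funᴵ (M [ x ∶ τ ≔ v ])) (Structure.funᴵ M)

  agree-≢ : ∀ {z} → z ≢ var (num τ) x →
            AgreeAt M (Structure.funᴵ (M [ x ∶ τ ≔ v ])) (Structure.funᴵ M) z
  agree-≢ z≢x = assign-elsewhere M τ (x ∷ []) (λ _ → v) (≢⇒∉[] z≢x)

  private
    agree : ∀ {zs} → var (num τ) x ∉ zs → C.Agree zs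
    agree x∉zs z∈zs = agree-≢ λ { refl → x∉zs z∈zs }

  update-lin : ∀ {τ′} (L : Lin τ′) → var (num τ) x ∉ symbLin L →
               ⟦ M [ x ∶ τ ≔ v ] ⟧ˡ L ≡ ⟦ M ⟧ˡ L
  update-lin L x∉L = C.coincide-lin L (agree x∉L)

  update-formula : ∀ φ → var (num τ) x ∉ symb φ → (M [ x ∶ τ ≔ v ] ⊨ᶠ φ) ≡ (M ⊨ᶠ φ)
  update-formula φ x∉φ = C.coincidence φ (agree x∉φ)

-- The substitution lemma: replacing x by u in the syntax amounts to assigning to x
-- the value of u.
module Substitution (M : Structure) (x : ℕ) {τ : Num} (u : Term (num τ)) where

  private
    M[u] = M [ x ∶ τ ≔ ⟦ M ⟧ u ]

  subst-term  : ∀ {s} (t : Term s) → ⟦ M ⟧ (substTerm x τ u t) ≡ ⟦ M[u] ⟧ t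
  subst-terms : ∀ {ds} (ts : All Term ds) → ⟦ M ⟧* (substTerms x τ u ts) ≡ ⟦ M[u] ⟧* ts
  subst-lin   : ∀ {τ′} (L : Lin τ′) → ⟦ M ⟧ˡ (substLin x τ u L) ≡ ⟦ M[u] ⟧ˡ L

  subst-term (app f {[]} {s} []) with s ≟ˢ num τ | f ℕ.≟ x | f ∈? (x ∷ [])
  ... | yes refl | yes _   | yes _   = refl
  ... | yes refl | yes f≡x | no f∉   = contradiction (here f≡x) f∉
  ... | yes refl | no f≢x  | yes f∈  = contradiction f∈ (≢⇒∉[] f≢x)
  ... | yes refl | no _    | no _    = refl
  ... | no _     | yes _   | yes _   = refl
  ... | no _     | yes _   | no _    = refl
  ... | no _     | no _    | yes _   = refl
  ... | no _     | no _    | no _    = refl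
  subst-term (app f {d ∷ ds} ts) = cong (Structure.funᴵ M f _ _) (subst-terms ts)
  subst-term (const c)           = refl
  subst-term (lin L)             = subst-lin L
  subst-term ⌊ t / k ⌋           = cong (ℤ._/ℕ k) (subst-term t)

  subst-terms []       = refl
  subst-terms (t ∷ ts) = cong₂ _∷_ (subst-term t) (subst-terms ts)

  subst-lin []            = refl
  subst-lin ((c , t) ∷ L) = cong₂ (λ v w → (c *ᵛ v) +ᵛ w) (subst-term t) (subst-lin L)

  subst-atom : ∀ α → ⟦ M ⟧ᵃ (substAtom x τ u α) ≡ ⟦ M[u] ⟧ᵃ α
  subst-atom (t ≈ t′)    = cong₂ _≡_ (subst-term t) (subst-term t′)
  subst-atom (L ≤ c)     = cong (_≤ᵇ c) (subst-lin L)
  subst-atom (pred p ts) = cong (λ vs → T (Structure.predᴵ M p _ vs)) (subst-terms ts)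

  substitution : ∀ F → (M ⊨ᶠ formulaBody (F ⟨ x ∶ τ ≔ u ⟩)) ≡ (M[u] ⊨ᶠ formulaBody F)
  substitution (lit (Sign.+ , α)) = subst-atom α
  substitution (lit (Sign.- , α)) = cong ¬_ (subst-atom α)
  substitution ⊤ⁿ                 = refl
  substitution ⊥ⁿ                 = refl
  substitution (F ∧ⁿ G)           = cong₂ _×_ (substitution F) (substitution G)
  substitution (F ∨ⁿ G)           = cong₂ _⊎_ (substitution F) (substitution G)

-- Substituting u for x leaves only symbols of u and symbols other than x, so that x
-- is eliminated if it does not occur in u.
module SubstitutionSymbols (x : ℕ) {τ : Num} (u : Term (num τ)) where

  Remaining : List Symbol → Symbol → Set
  Remaining zs z = (z ∈ zs × z ≢ var (num τ) x) ⊎ z ∈ symbTerm u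

  private
    weaken : ∀ {ys zs z} → (∀ {w} → w ∈ ys → w ∈ zs) → Remaining ys z → Remaining zs z
    weaken ys⊆zs = Sum.map₁ λ { (z∈ys , z≢x) → ys⊆zs z∈ys , z≢x }

    append : ∀ {ys′ zs′ z} ys zs → (z ∈ ys′ → Remaining ys z) →
             (z ∈ zs′ → Remaining zs z) → z ∈ ys′ ++ zs′ → Remaining (ys ++ zs) z
    append {ys′} ys zs l r z∈ with ∈-++⁻ ys′ z∈
    ... | inj₁ z∈ys′ = weaken ∈-++⁺ˡ (l z∈ys′)
    ... | inj₂ z∈zs′ = weaken (∈-++⁺ʳ ys) (r z∈zs′)

  symb-substTerm  : ∀ {s} (t : Term s) {z} → z ∈ symbTerm (substTerm x τ u t) →
                    Remaining (symbTerm t) z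
  symb-substTerms : ∀ {ds} (ts : All Term ds) {z} → z ∈ symbTerms (substTerms x τ u ts) →
                    Remaining (symbTerms ts) z
  symb-substLin   : ∀ {τ′} (L : Lin τ′) {z} → z ∈ symbLin (substLin x τ u L) →
                    Remaining (symbLin L) z

  symb-substTerm (app f {[]} {s} []) z∈ with s ≟ˢ num τ | f ℕ.≟ x
  symb-substTerm (app f {[]} {s} []) z∈          | yes refl | yes _  = inj₂ z∈
  symb-substTerm (app f {[]} {s} []) (here refl) | yes refl | no f≢x =
    inj₁ (here refl , λ { refl → f≢x refl })
  symb-substTerm (app f {[]} {s} []) (here refl) | no s≢ | yes _ =
    inj₁ (here refl , λ { refl → s≢ refl })
  symb-substTerm (app f {[]} {s} []) (here refl) | no s≢ | no _ =
    inj₁ (here refl , λ { refl → s≢ refl })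
  symb-substTerm (app f {d ∷ ds} ts) (here refl) = inj₁ (here refl , λ ())
  symb-substTerm (app f {d ∷ ds} ts) (there z∈)  = weaken there (symb-substTerms ts z∈)
  symb-substTerm (lin L)   z∈ = symb-substLin L z∈
  symb-substTerm ⌊ t / k ⌋ z∈ = symb-substTerm t z∈

  symb-substTerms (t ∷ ts) =
    append (symbTerm t) (symbTerms ts) (symb-substTerm t) (symb-substTerms ts)

  symb-substLin ((c , t) ∷ L) =
    append (symbTerm t) (symbLin L) (symb-substTerm t) (symb-substLin L)

  symb-substAtom : ∀ α {z} → z ∈ symbAtom (substAtom x τ u α) → Remaining (symbAtom α) z
  symb-substAtom (t ≈ t′) =
    append (symbTerm t) (symbTerm t′) (symb-substTerm t) (symb-substTerm t′)
  symb-substAtom (L ≤ c) = symb-substLin L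
  symb-substAtom (pred p ts) (here refl) = inj₁ (here refl , λ ())
  symb-substAtom (pred p ts) (there z∈)  = weaken there (symb-substTerms ts z∈)

  symb-substNNF : ∀ {X} (F : NNF X) {z} → z ∈ symbLits (substNNF x τ u F) →
                  Remaining (symbLits F) z
  symb-substNNF (lit (σ , α)) = symb-substAtom α
  symb-substNNF (F ∧ⁿ G) =
    append (symbLits F) (symbLits G) (symb-substNNF F) (symb-substNNF G)
  symb-substNNF (F ∨ⁿ G) =
    append (symbLits F) (symbLits G) (symb-substNNF F) (symb-substNNF G)

-- Filling the hole of a context

leaves-fill⁻ : ∀ J {G P} → P ∈ leaves (J [ G ]) → just P ∈ leaves J ⊎ P ∈ leaves G
leaves-fill⁻ (leaf nothing)  P∈          = inj₂ P∈
leaves-fill⁻ (leaf (just P)) (here refl) = inj₁ (here refl)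
leaves-fill⁻ (J ∧ⁿ K) {G} P∈ with ∈-++⁻ (leaves (J [ G ])) P∈
... | inj₁ P∈J = Sum.map₁ ∈-++⁺ˡ (leaves-fill⁻ J P∈J)
... | inj₂ P∈K = Sum.map₁ (∈-++⁺ʳ (leaves J)) (leaves-fill⁻ K P∈K)
leaves-fill⁻ (J ∨ⁿ K) {G} P∈ with ∈-++⁻ (leaves (J [ G ])) P∈
... | inj₁ P∈J = Sum.map₁ ∈-++⁺ˡ (leaves-fill⁻ J P∈J)
... | inj₂ P∈K = Sum.map₁ (∈-++⁺ʳ (leaves J)) (leaves-fill⁻ K P∈K)

leaves-fill⁺ : ∀ J {G P m} → m ∈ leaves J → P ∈ leaves (maybe leaf G m) → P ∈ leaves (J [ G ])
leaves-fill⁺ (leaf m) (here refl) P∈ = P∈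
leaves-fill⁺ (J ∧ⁿ K) {G} m∈ P∈ with ∈-++⁻ (leaves J) m∈
... | inj₁ m∈J = ∈-++⁺ˡ (leaves-fill⁺ J m∈J P∈)
... | inj₂ m∈K = ∈-++⁺ʳ (leaves (J [ G ])) (leaves-fill⁺ K m∈K P∈)
leaves-fill⁺ (J ∨ⁿ K) {G} m∈ P∈ with ∈-++⁻ (leaves J) m∈
... | inj₁ m∈J = ∈-++⁺ˡ (leaves-fill⁺ J m∈J P∈)
... | inj₂ m∈K = ∈-++⁺ʳ (leaves (J [ G ])) (leaves-fill⁺ K m∈K P∈)

symbLits-fill⁻ : ∀ J {G z} → z ∈ symbLits (J [ G ]) → z ∈ symbLits J ⊎ z ∈ symbLits G
symbLits-fill⁻ (leaf nothing) z∈ = inj₂ z∈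
symbLits-fill⁻ (lit ℓ)        z∈ = inj₁ z∈
symbLits-fill⁻ (J ∧ⁿ K) {G} z∈ with ∈-++⁻ (symbLits (J [ G ])) z∈
... | inj₁ z∈J = Sum.map₁ ∈-++⁺ˡ (symbLits-fill⁻ J z∈J)
... | inj₂ z∈K = Sum.map₁ (∈-++⁺ʳ (symbLits J)) (symbLits-fill⁻ K z∈K)
symbLits-fill⁻ (J ∨ⁿ K) {G} z∈ with ∈-++⁻ (symbLits (J [ G ])) z∈
... | inj₁ z∈J = Sum.map₁ ∈-++⁺ˡ (symbLits-fill⁻ J z∈J)
... | inj₂ z∈K = Sum.map₁ (∈-++⁺ʳ (symbLits J)) (symbLits-fill⁻ K z∈K)

symbLits-fill⁺ : ∀ J {G z} → z ∈ symbLits J → z ∈ symbLits (J [ G ])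
symbLits-fill⁺ (lit ℓ)  z∈ = z∈
symbLits-fill⁺ (J ∧ⁿ K) {G} z∈ with ∈-++⁻ (symbLits J) z∈
... | inj₁ z∈J = ∈-++⁺ˡ (symbLits-fill⁺ J z∈J)
... | inj₂ z∈K = ∈-++⁺ʳ (symbLits (J [ G ])) (symbLits-fill⁺ K z∈K)
symbLits-fill⁺ (J ∨ⁿ K) {G} z∈ with ∈-++⁻ (symbLits J) z∈
... | inj₁ z∈J = ∈-++⁺ˡ (symbLits-fill⁺ J z∈J)
... | inj₂ z∈K = ∈-++⁺ʳ (symbLits (J [ G ])) (symbLits-fill⁺ K z∈K)

symbLA-fill⁻ : ∀ J {G z} → z ∈ symbLA (J [ G ]) → z ∈ symbContext J ⊎ z ∈ symbLA G
symbLA-fill⁻ J {G} z∈ with ∈-++⁻ (symbLits (J [ G ])) z∈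
... | inj₁ z∈lits = Sum.map ∈-++⁺ˡ ∈-++⁺ˡ (symbLits-fill⁻ J z∈lits)
... | inj₂ z∈leaves with find (∈-concatMap⁻ symbLAPattern {leaves (J [ G ])} z∈leaves)
...   | P , P∈ , z∈P with leaves-fill⁻ J P∈
...     | inj₁ P∈J = inj₁ (∈-++⁺ʳ (symbLits J) (∈-concatMap⁺ (maybe symbLAPattern []) (lose P∈J z∈P)))
...     | inj₂ P∈G = inj₂ (∈-++⁺ʳ (symbLits G) (∈-concatMap⁺ symbLAPattern (lose P∈G z∈P)))

symbContext-fill⁺ : ∀ J {G z} → z ∈ symbContext J → z ∈ symbLA (J [ G ])
symbContext-fill⁺ J {G} z∈ with ∈-++⁻ (symbLits J) z∈
... | inj₁ z∈lits = ∈-++⁺ˡ (symbLits-fill⁺ J z∈lits)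
... | inj₂ z∈leaves with find (∈-concatMap⁻ (maybe symbLAPattern []) {leaves J} z∈leaves)
...   | just P , P∈ , z∈P = ∈-++⁺ʳ (symbLits (J [ G ]))
          (∈-concatMap⁺ symbLAPattern (lose (leaves-fill⁺ J P∈ (here refl)) z∈P))

symbHole-fill⁺ : ∀ J {P z} → nothing ∈ leaves J → z ∈ symbLAPattern P →
                 z ∈ symbLA (J [ leaf P ])
symbHole-fill⁺ J {P} hole z∈P = ∈-++⁺ʳ (symbLits (J [ leaf P ]))
  (∈-concatMap⁺ symbLAPattern (lose (leaves-fill⁺ J hole (here refl)) z∈P))

-- As the hole occurs positively, a formula in context is monotone in it.  The two
-- sides may be read in different structures that agree on the symbols of the context.
fill-mono : ∀ M g h J {G H} → Coincidence.Agree M g h (symbContext J) →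
            (reinterpret M g ⊨ᶠ formulaLA G → reinterpret M h ⊨ᶠ formulaLA H) →
            reinterpret M g ⊨ᶠ formulaLA (J [ G ]) → reinterpret M h ⊨ᶠ formulaLA (J [ H ])
fill-mono M g h J {G} {H} agree G⇒H =
  go J (agree ∘ ∈-++⁺ˡ)
       (λ P∈ z∈ → agree (∈-++⁺ʳ (symbLits J) (∈-concatMap⁺ (maybe symbLAPattern []) (lose P∈ z∈))))
  where
  open Coincidence M g h
  go : ∀ J → Agree (symbLits J) →
       (∀ {m} → m ∈ leaves J → Agree (maybe symbLAPattern [] m)) →
       reinterpret M g ⊨ᶠ formulaLA (J [ G ]) → reinterpret M h ⊨ᶠ formulaLA (J [ H ])
  go (leaf nothing)           lits pats = G⇒H
  go (leaf (just (LA s k F))) lits pats = subst id (coincidence (formulaBody F)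
    λ z∈ → pats (here refl) (∈-++⁺ʳ (symbLin (linLA s)) (subst (_ ∈_) (symb-body F) z∈)))
  go (lit ℓ)  lits pats = subst id (coincidence (literal ℓ)
    λ z∈ → lits (subst (_ ∈_) (symb-literal ℓ) z∈))
  go ⊤ⁿ       lits pats = id
  go (J ∧ⁿ K) lits pats (j , k) =
    go J (lits ∘ ∈-++⁺ˡ) (pats ∘ ∈-++⁺ˡ) j ,
    go K (lits ∘ ∈-++⁺ʳ (symbLits J)) (pats ∘ ∈-++⁺ʳ (leaves J)) k
  go (J ∨ⁿ K) lits pats =
    Sum.map (go J (lits ∘ ∈-++⁺ˡ) (pats ∘ ∈-++⁺ˡ))
            (go K (lits ∘ ∈-++⁺ʳ (symbLits J)) (pats ∘ ∈-++⁺ʳ (leaves J)))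

-- Linear terms: values and symbols

module Evaluation (M : Structure) where

  eval-++ : ∀ (L K : Lin τ) → ⟦ M ⟧ˡ (L ++ K) ≡ ⟦ M ⟧ˡ L +ᵛ ⟦ M ⟧ˡ K
  eval-++ []            K = sym (+ᵛ-identityˡ _)
  eval-++ ((c , t) ∷ L) K =
    trans (cong ((c *ᵛ ⟦ M ⟧ t) +ᵛ_) (eval-++ L K)) (sym (+ᵛ-assoc _ _ _))

  eval-· : ∀ c (L : Lin τ) → ⟦ M ⟧ˡ (c · L) ≡ c *ᵛ ⟦ M ⟧ˡ L
  eval-· c []            = sym (*ᵛ-zeroʳ c)
  eval-· c ((d , t) ∷ L) =
    trans (cong₂ _+ᵛ_ (*ᵛ-assoc c d _) (eval-· c L)) (sym (*ᵛ-distribˡ c _ _))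

  eval-neg : ∀ (L : Lin τ) → ⟦ M ⟧ˡ (-ˡ L) ≡ -ᵛ ⟦ M ⟧ˡ L
  eval-neg L = trans (eval-· _ L) (-1*ᵛ _)

  eval-*ᴾ : ∀ c (s : LATerm τ) → ⟦ M ⟧ˡ (linLA (c *ᴾ s)) ≡ val c *ᵛ ⟦ M ⟧ˡ (linLA s)
  eval-*ᴾ c ([] ⊹ L)             = eval-· (val c) L
  eval-*ᴾ c (((d , y) ∷ ys) ⊹ L) = trans
    (cong₂ _+ᵛ_ (trans (cong (_*ᵛ _) (val-*⁺ c d)) (*ᵛ-assoc _ _ _)) (eval-*ᴾ c (ys ⊹ L)))
    (sym (*ᵛ-distribˡ (val c) _ _))

  eval-+ᴾ : ∀ (s t : LATerm τ) →
            ⟦ M ⟧ˡ (linLA (s +ᴾ t)) ≡ ⟦ M ⟧ˡ (linLA s) +ᵛ ⟦ M ⟧ˡ (linLA t)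
  eval-+ᴾ ((x ∷ ys) ⊹ L) t =
    trans (cong (_ +ᵛ_) (eval-+ᴾ (ys ⊹ L) t)) (sym (+ᵛ-assoc _ _ _))
  eval-+ᴾ ([] ⊹ L) ([] ⊹ K)             = eval-++ L K
  eval-+ᴾ ([] ⊹ L) (((c , y) ∷ zs) ⊹ K) = begin
    a +ᵛ ⟦ M ⟧ˡ (linLA (zs ⊹ (L ++ K)))  ≡⟨ cong (a +ᵛ_) (eval-+ᴾ ([] ⊹ L) (zs ⊹ K)) ⟩
    a +ᵛ (l +ᵛ k)                        ≡⟨ sym (+ᵛ-assoc a l k) ⟩
    (a +ᵛ l) +ᵛ k                        ≡⟨ cong (_+ᵛ k) (+ᵛ-comm a l) ⟩
    (l +ᵛ a) +ᵛ k                        ≡⟨ +ᵛ-assoc l a k ⟩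
    l +ᵛ (a +ᵛ k)                        ∎
    where
    open ≡-Reasoning
    a = val c *ᵛ ⟦ M ⟧ {num _} ⟨ y ⟩
    l = ⟦ M ⟧ˡ L
    k = ⟦ M ⟧ˡ (linLA (zs ⊹ K))

  eval-s₃ : ∀ c₁ c₂ (s₁ s₂ : LATerm τ) → ⟦ M ⟧ˡ (linLA (s₃ c₁ c₂ s₁ s₂)) ≡
            (val c₂ *ᵛ ⟦ M ⟧ˡ (linLA s₁)) +ᵛ (val c₁ *ᵛ ⟦ M ⟧ˡ (linLA s₂))
  eval-s₃ c₁ c₂ s₁ s₂ =
    trans (eval-+ᴾ (c₂ *ᴾ s₁) (c₁ *ᴾ s₂)) (cong₂ _+ᵛ_ (eval-*ᴾ c₂ s₁) (eval-*ᴾ c₁ s₂))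

symb-++ : ∀ (L K : Lin τ) → symbLin (L ++ K) ≡ symbLin L ++ symbLin K
symb-++ []            K = refl
symb-++ ((c , t) ∷ L) K =
  trans (cong (symbTerm t ++_) (symb-++ L K)) (sym (List.++-assoc (symbTerm t) _ _))

symb-· : ∀ c (L : Lin τ) → symbLin (c · L) ≡ symbLin L
symb-· c []            = refl
symb-· c ((d , t) ∷ L) = cong (symbTerm t ++_) (symb-· c L)

symb-linLA : ∀ (s : LATerm τ) → symbLin (linLA s) ≡ map (var (num τ)) (names s) ++ symbLin (others s)
symb-linLA ([] ⊹ L)             = refl
symb-linLA (((c , y) ∷ ys) ⊹ L) = cong (_ ∷_) (symb-linLA (ys ⊹ L))

names-*ᴾ : ∀ c (s : LATerm τ) → names (c *ᴾ s) ≡ names s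
names-*ᴾ c ([] ⊹ L)       = refl
names-*ᴾ c ((x ∷ ys) ⊹ L) = cong (_ ∷_) (names-*ᴾ c (ys ⊹ L))

names-+ᴾ : ∀ (s t : LATerm τ) → names (s +ᴾ t) ≡ names s ++ names t
names-+ᴾ ([] ⊹ L)       t = refl
names-+ᴾ ((x ∷ ys) ⊹ L) t = cong (_ ∷_) (names-+ᴾ (ys ⊹ L) t)

names-s₃ : ∀ c₁ c₂ (s₁ s₂ : LATerm τ) → names (s₃ c₁ c₂ s₁ s₂) ≡ names s₁ ++ names s₂
names-s₃ c₁ c₂ s₁ s₂ = trans (names-+ᴾ (c₂ *ᴾ s₁) (c₁ *ᴾ s₂))
  (cong₂ _++_ (names-*ᴾ c₂ s₁) (names-*ᴾ c₁ s₂))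

symb-others-s₃ : ∀ c₁ c₂ (s₁ s₂ : LATerm τ) → symbLin (others (s₃ c₁ c₂ s₁ s₂)) ≡
                 symbLin (others s₁) ++ symbLin (others s₂)
symb-others-s₃ c₁ c₂ s₁ s₂ = trans (symb-++ (val c₂ · others s₁) (val c₁ · others s₂))
  (cong₂ _++_ (symb-· (val c₂) (others s₁)) (symb-· (val c₁) (others s₂)))

linLA-cases : ∀ (s : LATerm τ) {z} → z ∈ symbLin (linLA s) →
              z ∈ map (var (num τ)) (names s) ⊎ z ∈ symbLin (others s)
linLA-cases {τ} s z∈ = ∈-++⁻ (map (var (num τ)) (names s)) (subst (_ ∈_) (symb-linLA s) z∈)

∈-linLA-names : ∀ (s : LATerm τ) {z} → z ∈ map (var (num τ)) (names s) → z ∈ symbLin (linLA s)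
∈-linLA-names s z∈ = subst (_ ∈_) (sym (symb-linLA s)) (∈-++⁺ˡ z∈)

∈-linLA-others : ∀ (s : LATerm τ) {z} → z ∈ symbLin (others s) → z ∈ symbLin (linLA s)
∈-linLA-others {τ} s z∈ =
  subst (_ ∈_) (sym (symb-linLA s)) (∈-++⁺ʳ (map (var (num τ)) (names s)) z∈)

∈-names-s₃ : ∀ c₁ c₂ (s₁ s₂ : LATerm τ) {z} →
             z ∈ map (var (num τ)) (names s₁) ⊎ z ∈ map (var (num τ)) (names s₂) →
             z ∈ map (var (num τ)) (names (s₃ c₁ c₂ s₁ s₂))
∈-names-s₃ {τ} c₁ c₂ s₁ s₂ z∈ = subst (_ ∈_)
  (trans (sym (List.map-++ (var (num τ)) (names s₁) (names s₂)))
         (cong (map (var (num τ))) (sym (names-s₃ c₁ c₂ s₁ s₂))))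
  (Sum.[ ∈-++⁺ˡ , ∈-++⁺ʳ (map (var (num τ)) (names s₁)) ] z∈)

symb-s₃ : ∀ c₁ c₂ (s₁ s₂ : LATerm τ) {z} → z ∈ symbLin (linLA (s₃ c₁ c₂ s₁ s₂)) →
          z ∈ symbLin (linLA s₁) ⊎ z ∈ symbLin (linLA s₂)
symb-s₃ {τ} c₁ c₂ s₁ s₂ z∈ with linLA-cases (s₃ c₁ c₂ s₁ s₂) z∈
... | inj₁ z∈names = Sum.map (∈-linLA-names s₁) (∈-linLA-names s₂)
        (∈-++⁻ (map (var (num τ)) (names s₁)) (subst (_ ∈_)
          (trans (cong (map (var (num τ))) (names-s₃ c₁ c₂ s₁ s₂))
                 (List.map-++ (var (num τ)) (names s₁) (names s₂))) z∈names))
... | inj₂ z∈others = Sum.map (∈-linLA-others s₁) (∈-linLA-others s₂)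
        (∈-++⁻ (symbLin (others s₁)) (subst (_ ∈_) (symb-others-s₃ c₁ c₂ s₁ s₂) z∈others))

⊨-⋁⁺ : ∀ M (D : ℕ → Body) {i n} → i ℕ.< n → M ⊨ᶠ formulaBody (D i) →
       M ⊨ᶠ formulaBody (⋁ (map D (upTo n)))
⊨-⋁⁺ M D i<n ⊨Di = go (∈-map⁺ D (∈-upTo⁺ i<n))
  where
  go : ∀ {Fs} → D _ ∈ Fs → M ⊨ᶠ formulaBody (⋁ Fs)
  go (here refl) = inj₁ ⊨Di
  go (there D∈)  = inj₂ (go D∈)

⊨-⋁⁻ : ∀ M (D : ℕ → Body) ns → M ⊨ᶠ formulaBody (⋁ (map D ns)) →
       ∃ λ i → M ⊨ᶠ formulaBody (D i)
⊨-⋁⁻ M D (i ∷ ns) (inj₁ ⊨Di) = i , ⊨Di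
⊨-⋁⁻ M D (i ∷ ns) (inj₂ ⊨⋁)  = ⊨-⋁⁻ M D ns ⊨⋁

symb-⋁ : ∀ (D : ℕ → Body) ns {z} → z ∈ symbLits (⋁ (map D ns)) → ∃ λ i → z ∈ symbLits (D i)
symb-⋁ D (i ∷ ns) z∈ with ∈-++⁻ (symbLits (D i)) z∈
... | inj₁ z∈D = i , z∈D
... | inj₂ z∈⋁ = symb-⋁ D ns z∈⋁

-- Well-formed patterns as sets of values

module WellFormedPatterns (aux : AuxNaming) where
  open AuxNaming aux

  -- Monotonicity of F, for structures that need not arise by assigning values to the
  -- variables of s: it is enough that they differ in F at most at these variables.
  pattern-mono : ∀ {P} → WellFormed P → let open LAPattern P in
    ∀ M (g h : InterpretationOf M) →
    (∀ {y} → y ∈ names s → h y [] (num sort) [] ≤ᵛ g y [] (num sort) []) →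
    (∀ {z} → z ∈ symbLits F → z ∉ map (var (num sort)) (names s) → AgreeAt M g h z) →
    reinterpret M g ⊨ᶠ formulaBody F → reinterpret M h ⊨ᶠ formulaBody F
  pattern-mono {LA {τ} s k F} wf M g h h≤g agree =
    subst id (assigned h (λ z∈ z∉ → agree (subst (_ ∈_) (symb-body F) z∈) z∉)) ∘
    WellFormed.monotone wf G (value g) (value h) h≤g ∘
    subst id (sym (assigned g (λ {z} _ _ → agree-refl M z)))
    where
    G : Structure
    G = reinterpret M g
    value : InterpretationOf M → ℕ → Val τ
    value i y = i y [] (num τ) []
    assigned : ∀ i →
      (∀ {z} → z ∈ symb (formulaBody F) → z ∉ map (var (num τ)) (names s) → AgreeAt M g i z) →
      (assign G τ (names s) (value i) ⊨ᶠ formulaBody F) ≡ (reinterpret M i ⊨ᶠ formulaBody F)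
    assigned i outside =
      Coincidence.coincidence M (Structure.funᴵ (assign G τ (names s) (value i))) i (formulaBody F)
        λ {z} z∈ → assign-agree G τ (names s) (value i) i z (λ _ _ → refl) (outside z∈)

  -- A pattern in which one of the variables, x, is singled out.
  module Variable {x : ℕ} {c : Pos τ} {s : LATerm τ} {k : Slack τ} {F : Body}
                  (wf : WellFormed (LA (c ·ᵖ x +ᴾ s) k F)) (x∉s : x ∉ names s) where
    open WellFormed wf

    x-aux : IneqAux (var (num τ) x)
    x-aux = All.head aux-vars

    x∉linLA : var (num τ) x ∉ symbLin (linLA s)
    x∉linLA x∈ with linLA-cases s x∈
    ... | inj₂ x∈others = others-free x∈others x-aux
    ... | inj₁ x∈names with ∈-map⁻ (var (num τ)) x∈names
    ...   | _ , x∈s , refl = x∉s x∈s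

    -- F is preserved when the value of x is lowered from v to v′ and the values of the
    -- other variables of s are lowered as well.
    lower-others : ∀ M (g h : InterpretationOf M) (v v′ : Val τ) → v′ ≤ᵛ v →
      (∀ {y} → y ∈ names s → h y [] (num τ) [] ≤ᵛ g y [] (num τ) []) →
      (∀ {z} → z ∈ symbLits F → z ∉ map (var (num τ)) (x ∷ names s) → AgreeAt M g h z) →
      reinterpret M g [ x ∶ τ ≔ v ] ⊨ᶠ formulaBody F →
      reinterpret M h [ x ∶ τ ≔ v′ ] ⊨ᶠ formulaBody F
    lower-others M g h v v′ v′≤v h≤g agree = pattern-mono wf M
      (Structure.funᴵ (reinterpret M g [ x ∶ τ ≔ v ]))
      (Structure.funᴵ (reinterpret M h [ x ∶ τ ≔ v′ ]))
      (λ { (here refl) → subst₂ _≤ᵛ_ (sym (at-x h v′)) (sym (at-x g v)) v′≤v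
         ; {y} (there y∈s) → subst₂ _≤ᵛ_ (sym (off-x h v′ y∈s)) (sym (off-x g v y∈s)) (h≤g y∈s) })
      (λ {z} z∈F z∉ →
        let z≢x = λ z≡x → z∉ (here z≡x) in
        agree-trans M z (Update.agree-≢ (reinterpret M g) x v z≢x)
          (agree-trans M z (agree z∈F z∉)
            (agree-sym M z (Update.agree-≢ (reinterpret M h) x v′ z≢x))))
      where
      at-x : ∀ i v → ⟦ reinterpret M i [ x ∶ τ ≔ v ] ⟧ {num τ} ⟨ x ⟩ ≡ v
      at-x i v = assign-here (reinterpret M i) τ (x ∷ []) (λ _ → v) (here refl)
      off-x : ∀ i v {y} → y ∈ names s →
              ⟦ reinterpret M i [ x ∶ τ ≔ v ] ⟧ {num τ} ⟨ y ⟩ ≡ i y [] (num τ) []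
      off-x i v y∈s = Update.agree-≢ (reinterpret M i) x v (λ { refl → x∉s y∈s }) []

    profile : ∀ M → Profile c (⟦ M ⟧ˡ (linLA s)) k (Holds M x F)
    profile M = record
      { closed-≤ = λ {v} {w} w≤v → lower-others M (Structure.funᴵ M) (Structure.funᴵ M) v w w≤v
                     (λ _ → ≤ᵛ-refl) (λ {z} _ _ → agree-refl M z)
      ; bounded  = λ {v} ⊨F 0<sum → F-⊥ (M [ x ∶ τ ≔ v ]) (subst (0ᵛ <ᵛ_) (sym (sum v)) 0<sum) ⊨F
      ; holds    = λ {v} sum<-k → F-⊤ (M [ x ∶ τ ≔ v ]) (subst (_<- k) (sym (sum v)) sum<-k)
      }
      where
      sum : ∀ v → ⟦ M [ x ∶ τ ≔ v ] ⟧ˡ (linLA (c ·ᵖ x +ᴾ s)) ≡ (val c *ᵛ v) +ᵛ ⟦ M ⟧ˡ (linLA s)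
      sum v = cong₂ (λ a b → (val c *ᵛ a) +ᵛ b)
        (assign-here M τ (x ∷ []) (λ _ → v) (here refl))
        (Update.update-lin M x v (linLA s) x∉linLA)

-- The resolvent F₃

module SubstitutedValue {τ : Num} (M : Structure) (x : ℕ) (F : Body) (u : Term (num τ))
                        {v : Val τ} (u≡v : ⟦ M ⟧ u ≡ v) where

  private
    equivalent : (M ⊨ᶠ formulaBody (F ⟨ x ∶ τ ≔ u ⟩)) ≡ Holds M x F v
    equivalent = trans (Substitution.substitution M x u F) (cong (Holds M x F) u≡v)

  holds⇒subst : Holds M x F v → M ⊨ᶠ formulaBody (F ⟨ x ∶ τ ≔ u ⟩)
  holds⇒subst = subst id (sym equivalent)

  subst⇒holds : M ⊨ᶠ formulaBody (F ⟨ x ∶ τ ≔ u ⟩) → Holds M x F v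
  subst⇒holds = subst id equivalent

open SubstitutedValue

-- The terms and the disjuncts of F₃ in the integer case, spelled so that they are
-- definitionally those of F₃.
module F₃-Int (c₁ : Pos int) (s₁ : LATerm int) (k₁ : ℤ) (x₁ x₂ : ℕ) (F₁ F₂ : Body) where

  private
    n₁ = proj₁ c₁
    instance
      n₁≢0 : NonZero n₁
      n₁≢0 = proj₂ c₁

  quotient : Term (num int)
  quotient = ⌊ lin (-ˡ linLA s₁) / n₁ ⌋

  arg₁ arg₂ : ℕ → Term (num int)
  arg₁ i = lin ((1ℤ , quotient) ∷ (-1ℤ , const (+ i)) ∷ [])
  arg₂ i = lin ((1ℤ , const (+ i)) ∷ (-1ℤ , quotient) ∷ [])

  indices : List ℕ
  indices = upTo (suc ℤ.∣ ⌈ k₁ ℤ.+ 1ℤ / n₁ ⌉ ∣)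

  disjunct : ℕ → Body
  disjunct i = (F₁ ⟨ x₁ ∶ int ≔ arg₁ i ⟩) ∧ⁿ (F₂ ⟨ x₂ ∶ int ≔ arg₂ i ⟩)

  module _ (M : Structure) where

    ⌊-S₁/c₁⌋ : ℤ
    ⌊-S₁/c₁⌋ = (ℤ.- ⟦ M ⟧ˡ (linLA s₁)) ℤ./ℕ n₁

    value₁ : ∀ i → ⟦ M ⟧ (arg₁ i) ≡ ⌊-S₁/c₁⌋ ℤ.- + i
    value₁ i = trans (cong (λ S → 1ℤ ℤ.* (S ℤ./ℕ n₁) ℤ.+ (-1ℤ ℤ.* + i ℤ.+ 0ℤ))
                           (Evaluation.eval-neg M (linLA s₁)))
                     (ring ⌊-S₁/c₁⌋ (+ i))
      where
      ring : ∀ t i → 1ℤ ℤ.* t ℤ.+ (-1ℤ ℤ.* i ℤ.+ 0ℤ) ≡ t ℤ.- i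
      ring = ℤ-Solver.solve-∀

    value₂ : ∀ i → ⟦ M ⟧ (arg₂ i) ≡ + i ℤ.- ⌊-S₁/c₁⌋
    value₂ i = trans (cong (λ S → 1ℤ ℤ.* + i ℤ.+ (-1ℤ ℤ.* (S ℤ./ℕ n₁) ℤ.+ 0ℤ))
                           (Evaluation.eval-neg M (linLA s₁)))
                     (ring ⌊-S₁/c₁⌋ (+ i))
      where
      ring : ∀ t i → 1ℤ ℤ.* i ℤ.+ (-1ℤ ℤ.* t ℤ.+ 0ℤ) ≡ i ℤ.- t
      ring = ℤ-Solver.solve-∀

-- The terms s₁/c₁ and -s₁/c₁ of F₃ in the rational case, likewise.
module F₃-Rat (c₁ : Pos rat) (s₁ : LATerm rat) where

  quotient -quotient : Term (num rat)
  quotient  = lin (1/⁺ c₁ · linLA s₁)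
  -quotient = lin (-ˡ (1/⁺ c₁ · linLA s₁))

  module _ (M : Structure) where

    S₁/c₁ : ℚ
    S₁/c₁ = ⟦ M ⟧ quotient

    c₁*S₁/c₁ : proj₁ c₁ ℚ.* S₁/c₁ ≡ ⟦ M ⟧ˡ (linLA s₁)
    c₁*S₁/c₁ = trans (cong (proj₁ c₁ ℚ.*_) (Evaluation.eval-· M (1/⁺ c₁) (linLA s₁)))
                     (*-1/⁺-cancel c₁ (⟦ M ⟧ˡ (linLA s₁)))

    -value : ⟦ M ⟧ -quotient ≡ ℚ.- S₁/c₁
    -value = Evaluation.eval-neg M (1/⁺ c₁ · linLA s₁)

-- P(v) and Q(-v) hold for some v.
Witness : ∀ {τ} → (P Q : Val τ → Set) → Set
Witness {τ} P Q = ∃ λ (v : Val τ) → P v × Q (-ᵛ v)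

-- F₃(x⃗) holds if and only if F₁(v, x⃗) and F₂(-v, x⃗) hold for some v.

witness⇒F₃ :
  ∀ {τ} M {c₁ c₂ : Pos τ} {s₁ s₂ : LATerm τ} {k₁ k₂ : Slack τ} {x₁ x₂ : ℕ} {F₁ F₂ : Body}
  (p : Profile c₁ (⟦ M ⟧ˡ (linLA s₁)) k₁ (Holds M x₁ F₁))
  (q : Profile c₂ (⟦ M ⟧ˡ (linLA s₂)) k₂ (Holds M x₂ F₂)) → ValidSlack k₁ →
  Witness {τ} (Holds M x₁ F₁) (Holds M x₂ F₂) →
  M ⊨ᶠ formulaBody (F₃ c₁ c₂ s₁ s₂ k₁ x₁ x₂ F₁ F₂)
witness⇒F₃ {int} M {c₁} {c₂} {s₁} {s₂} {k₁} {k₂} {x₁} {x₂} {F₁} {F₂} p q -1≤k₁ (_ , Pv , Qv) =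
  let i , i<N , Pi , Qi = Resolveℤ.witness⇒index p q -1≤k₁ Pv Qv in
  ⊨-⋁⁺ M disjunct i<N
    (holds⇒subst M x₁ F₁ (arg₁ i) (value₁ M i) Pi , holds⇒subst M x₂ F₂ (arg₂ i) (value₂ M i) Qi)
  where open F₃-Int c₁ s₁ k₁ x₁ x₂ F₁ F₂
witness⇒F₃ {rat} M {c₁} {s₁ = s₁} {k₁ = minus-ε} {x₂ = x₂} {F₂ = F₂} p q _ (_ , Pv , Qv) =
  holds⇒subst M x₂ F₂ quotient refl
    (Profile.closed-≤ q (Resolveℚ.w≤-v (c₁*S₁/c₁ M) p q Pv) Qv)
  where open F₃-Rat c₁ s₁
witness⇒F₃ {rat} M {c₁} {c₂} {s₁} {s₂} {zero} {x₁ = x₁} {x₂} {F₁} {F₂} p q _ (_ , Pv , Qv) =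
  Sum.map (subst (ℚ._< 0ℚ) (sym (Evaluation.eval-s₃ M c₁ c₂ s₁ s₂)))
    (λ (P-w , Qw) → holds⇒subst M x₁ F₁ -quotient (-value M) P-w ,
                    holds⇒subst M x₂ F₂ quotient refl Qw)
    (Resolveℚ.witness⇒strict-or-quotient (c₁*S₁/c₁ M) p q Pv Qv)
  where open F₃-Rat c₁ s₁

F₃⇒witness :
  ∀ {τ} M {c₁ c₂ : Pos τ} {s₁ s₂ : LATerm τ} {k₁ k₂ : Slack τ} {x₁ x₂ : ℕ} {F₁ F₂ : Body}
  (p : Profile c₁ (⟦ M ⟧ˡ (linLA s₁)) k₁ (Holds M x₁ F₁))
  (q : Profile c₂ (⟦ M ⟧ˡ (linLA s₂)) k₂ (Holds M x₂ F₂)) →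
  M ⊨ᶠ formulaBody (F₃ c₁ c₂ s₁ s₂ k₁ x₁ x₂ F₁ F₂) →
  Witness {τ} (Holds M x₁ F₁) (Holds M x₂ F₂)
F₃⇒witness {int} M {c₁} {c₂} {s₁} {s₂} {k₁} {k₂} {x₁} {x₂} {F₁} {F₂} p q ⊨F₃ =
  let i , ⊨₁ , ⊨₂ = ⊨-⋁⁻ M disjunct indices ⊨F₃ in
  Resolveℤ.index⇒witness p q i
    (subst⇒holds M x₁ F₁ (arg₁ i) (value₁ M i) ⊨₁)
    (subst⇒holds M x₂ F₂ (arg₂ i) (value₂ M i) ⊨₂)
  where open F₃-Int c₁ s₁ k₁ x₁ x₂ F₁ F₂
F₃⇒witness {rat} M {c₁} {s₁ = s₁} {k₁ = minus-ε} {x₂ = x₂} {F₂ = F₂} p q ⊨F₃ =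
  quotient⇒witness (Profile.holds p (ℚ.≤-reflexive sum-at-quotient))
                   (subst⇒holds M x₂ F₂ quotient refl ⊨F₃)
  where
  open F₃-Rat c₁ s₁
  open Resolveℚ (c₁*S₁/c₁ M) p q
F₃⇒witness {rat} M {c₁} {c₂} {s₁} {s₂} {zero} {x₁ = x₁} {x₂} {F₁} {F₂} p q = Sum.[
    (λ s₃<0 → strict⇒witness (subst (ℚ._< 0ℚ) (Evaluation.eval-s₃ M c₁ c₂ s₁ s₂) s₃<0)) ,
    (λ (⊨₁ , ⊨₂) → quotient⇒witness (subst⇒holds M x₁ F₁ -quotient (-value M) ⊨₁)
                                    (subst⇒holds M x₂ F₂ quotient refl ⊨₂)) ]′
  where
  open F₃-Rat c₁ s₁
  open Resolveℚ (c₁*S₁/c₁ M) p q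

-- The boundary conditions on LA(s₃, k₃, F₃), in terms of witnesses.
witness⇒s₃≤0 :
  ∀ {τ} {c₁ c₂ : Pos τ} {S₁ S₂ : Val τ} {k₁ k₂ : Slack τ} {P Q : Val τ → Set} →
  Profile c₁ S₁ k₁ P → Profile c₂ S₂ k₂ Q →
  Witness P Q → ¬ (0ᵛ <ᵛ (val c₂ *ᵛ S₁) +ᵛ (val c₁ *ᵛ S₂))
witness⇒s₃≤0 {int}              p q (_ , Pv , Qv) = Resolveℤ.combined-≤0 p q Pv Qv
witness⇒s₃≤0 {rat} {c₁} {c₂} {S₁} p q (_ , Pv , Qv) =
  Resolveℚ.combined-≤0 (*-1/⁺-cancel c₁ S₁) p q Pv Qv

s₃<-k₃⇒witness :
  ∀ {τ} {c₁ c₂ : Pos τ} {S₁ S₂ : Val τ} {k₁ k₂ : Slack τ} {P Q : Val τ → Set} →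
  Profile c₁ S₁ k₁ P → Profile c₂ S₂ k₂ Q →
  ((val c₂ *ᵛ S₁) +ᵛ (val c₁ *ᵛ S₂)) <- k₃ c₁ c₂ k₁ k₂ → Witness P Q
s₃<-k₃⇒witness {int}                         p q s₃<-k₃ = Resolveℤ.combined-< p q s₃<-k₃
s₃<-k₃⇒witness {rat} {c₁} {S₁ = S₁} {k₁ = zero}    p q s₃<0  =
  Resolveℚ.strict⇒witness (*-1/⁺-cancel c₁ S₁) p q s₃<0
s₃<-k₃⇒witness {rat} {c₁} {S₁ = S₁} {k₁ = minus-ε} p q s₃<-k₂ =
  quotient⇒witness (Profile.holds p (ℚ.≤-reflexive sum-at-quotient))
                   (Profile.holds q (sum₂-<- s₃<-k₂))
  where open Resolveℚ (*-1/⁺-cancel c₁ S₁) p q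

k₃-valid : ∀ {τ} (c₁ c₂ : Pos τ) (k₁ k₂ : Slack τ) → ValidSlack k₁ → ValidSlack k₂ →
           ValidSlack (k₃ c₁ c₂ k₁ k₂)
k₃-valid {int} (n₁ , n₁≢0) (n₂ , n₂≢0) k₁ k₂ = combined-slack n₁ n₂ {{n₁≢0}} {{n₂≢0}}
k₃-valid {rat} c₁ c₂ k₁ k₂ _ _ = tt

-- The symbols that F₃ may contain: those of F₁ and F₂ without the eliminated
-- variables, and those of the terms s₁ and s₂.
data ResolventSymbol {τ} (s₁ s₂ : LATerm τ) (x₁ x₂ : ℕ) (F₁ F₂ : Body) (z : Symbol) : Set where
  from-F₁ : z ∈ symbLits F₁ → z ≢ var (num τ) x₁ → ResolventSymbol s₁ s₂ x₁ x₂ F₁ F₂ z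
  from-F₂ : z ∈ symbLits F₂ → z ≢ var (num τ) x₂ → ResolventSymbol s₁ s₂ x₁ x₂ F₁ F₂ z
  from-s₁ : z ∈ symbLin (linLA s₁) → ResolventSymbol s₁ s₂ x₁ x₂ F₁ F₂ z
  from-s₂ : z ∈ symbLin (linLA s₂) → ResolventSymbol s₁ s₂ x₁ x₂ F₁ F₂ z

module _ {τ} {s₁ s₂ : LATerm τ} {x₁ x₂ : ℕ} {F₁ F₂ : Body} where

  symb-subst₁ : ∀ u {z} → (z ∈ symbTerm u → z ∈ symbLin (linLA s₁)) →
                z ∈ symbLits (F₁ ⟨ x₁ ∶ τ ≔ u ⟩) → ResolventSymbol s₁ s₂ x₁ x₂ F₁ F₂ z
  symb-subst₁ u u⊆s₁ z∈ with SubstitutionSymbols.symb-substNNF x₁ u F₁ z∈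
  ... | inj₁ (z∈F₁ , z≢x₁) = from-F₁ z∈F₁ z≢x₁
  ... | inj₂ z∈u           = from-s₁ (u⊆s₁ z∈u)

  symb-subst₂ : ∀ u {z} → (z ∈ symbTerm u → z ∈ symbLin (linLA s₁)) →
                z ∈ symbLits (F₂ ⟨ x₂ ∶ τ ≔ u ⟩) → ResolventSymbol s₁ s₂ x₁ x₂ F₁ F₂ z
  symb-subst₂ u u⊆s₁ z∈ with SubstitutionSymbols.symb-substNNF x₂ u F₂ z∈
  ... | inj₁ (z∈F₂ , z≢x₂) = from-F₂ z∈F₂ z≢x₂
  ... | inj₂ z∈u           = from-s₁ (u⊆s₁ z∈u)

  symb-∧ : ∀ u₁ u₂ {z} → (z ∈ symbTerm u₁ → z ∈ symbLin (linLA s₁)) →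
    (z ∈ symbTerm u₂ → z ∈ symbLin (linLA s₁)) →
    z ∈ symbLits ((F₁ ⟨ x₁ ∶ τ ≔ u₁ ⟩) ∧ⁿ (F₂ ⟨ x₂ ∶ τ ≔ u₂ ⟩)) →
    ResolventSymbol s₁ s₂ x₁ x₂ F₁ F₂ z
  symb-∧ u₁ u₂ u₁⊆s₁ u₂⊆s₁ z∈ with ∈-++⁻ (symbLits (F₁ ⟨ x₁ ∶ τ ≔ u₁ ⟩)) z∈
  ... | inj₁ z∈₁ = symb-subst₁ u₁ u₁⊆s₁ z∈₁
  ... | inj₂ z∈₂ = symb-subst₂ u₂ u₂⊆s₁ z∈₂

symb-F₃ : ∀ {τ} (c₁ c₂ : Pos τ) s₁ s₂ k₁ x₁ x₂ F₁ F₂ {z} →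
          z ∈ symbLits (F₃ c₁ c₂ s₁ s₂ k₁ x₁ x₂ F₁ F₂) →
          ResolventSymbol s₁ s₂ x₁ x₂ F₁ F₂ z
symb-F₃ {int} c₁ c₂ s₁ s₂ k₁ x₁ x₂ F₁ F₂ {z} z∈ =
  let i , z∈i = symb-⋁ disjunct indices z∈ in
  symb-∧ (arg₁ i) (arg₂ i) (in-s₁ ∘ ∈-++[]⁻) (in-s₁ ∘ ∈-++[]⁻) z∈i
  where
  open F₃-Int c₁ s₁ k₁ x₁ x₂ F₁ F₂
  ∈-++[]⁻ : z ∈ symbLin (-ˡ linLA s₁) ++ [] → z ∈ symbLin (-ˡ linLA s₁)
  ∈-++[]⁻ = subst (z ∈_) (List.++-identityʳ _)
  in-s₁ : z ∈ symbLin (-ˡ linLA s₁) → z ∈ symbLin (linLA s₁)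
  in-s₁ = subst (z ∈_) (symb-· -1ℤ (linLA s₁))
symb-F₃ {rat} c₁ c₂ s₁ s₂ minus-ε x₁ x₂ F₁ F₂ =
  symb-subst₂ quotient (subst (_ ∈_) (symb-· _ (linLA s₁)))
  where open F₃-Rat c₁ s₁
symb-F₃ {rat} c₁ c₂ s₁ s₂ zero x₁ x₂ F₁ F₂ {z} z∈
  with ∈-++⁻ (symbLin (linLA (s₃ c₁ c₂ s₁ s₂))) z∈
... | inj₁ z∈s₃ = Sum.[ from-s₁ , from-s₂ ]′ (symb-s₃ c₁ c₂ s₁ s₂ z∈s₃)
... | inj₂ z∈∧  = symb-∧ -quotient quotient
        (in-s₁ ∘ subst (z ∈_) (symb-· _ (1/⁺ c₁ · linLA s₁))) in-s₁ z∈∧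
  where
  open F₃-Rat c₁ s₁
  in-s₁ : z ∈ symbTerm quotient → z ∈ symbLin (linLA s₁)
  in-s₁ = subst (z ∈_) (symb-· _ (linLA s₁))

-- Projections and their auxiliary variables

interleaving-left : ∀ {τ} {a b L : Lin τ} → Interleaving a b L →
                    ∀ {z} → z ∈ symbLin a → z ∈ symbLin L
interleaving-left {a = (c , t) ∷ a} (consˡ sp) =
  ∈-++-elim (symbTerm t) ∈-++⁺ˡ (∈-++⁺ʳ (symbTerm t) ∘ interleaving-left sp)
interleaving-left {L = (c , t) ∷ L} (consʳ sp) = ∈-++⁺ʳ (symbTerm t) ∘ interleaving-left sp

interleaving-right : ∀ {τ} {a b L : Lin τ} → Interleaving a b L →
                     ∀ {z} → z ∈ symbLin b → z ∈ symbLin L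
interleaving-right {b = (c , t) ∷ b} (consʳ sp) =
  ∈-++-elim (symbTerm t) ∈-++⁺ˡ (∈-++⁺ʳ (symbTerm t) ∘ interleaving-right sp)
interleaving-right {L = (c , t) ∷ L} (consˡ sp) = ∈-++⁺ʳ (symbTerm t) ∘ interleaving-right sp

module Projection (style : Style) (problem : InterpolationProblem) (aux : AuxNaming) where
  open InterpolationProblem problem
  open AuxNaming aux
  open Interpolation style problem aux

  private
    symb-eq : ∀ {s} (t u : Term s) {x z} →
      z ∈ symbTerm t ++ x ∷ [] → z ∈ symbTerm t ++ symbTerm u ⊎ z ∈ x ∷ []
    symb-eq t u = ∈-++-elim (symbTerm t) (inj₁ ∘ ∈-++⁺ˡ) inj₂

    symb-eq˘ : ∀ {s} (t u : Term s) {x z} →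
      z ∈ symbTerm t ++ x ∷ [] → z ∈ symbTerm u ++ symbTerm t ⊎ z ∈ x ∷ []
    symb-eq˘ t u = ∈-++-elim (symbTerm t) (inj₁ ∘ ∈-++⁺ʳ (symbTerm u)) inj₂

    symb-xor : ∀ {p x : Symbol} {ys zs z} → (z ∈ ys → z ∈ zs ⊎ z ∈ x ∷ []) →
      z ∈ (p ∷ ys) ++ (p ∷ ys) → z ∈ zs ⊎ z ∈ x ∷ p ∷ []
    symb-xor {p} {x} {ys} {zs} {z} ys⊆ = ∈-++-elim (p ∷ ys) half half
      where
      half : z ∈ p ∷ ys → z ∈ zs ⊎ z ∈ x ∷ p ∷ []
      half (here refl) = inj₂ (there (here refl))
      half (there z∈)  = Sum.map₂ ∈-++⁺ˡ (ys⊆ z∈)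

    swap : ∀ {s} (x : Symbol) (t : Term s) {z} → z ∈ x ∷ symbTerm t → z ∈ symbTerm t ++ x ∷ []
    swap x t (here refl) = ∈-++⁺ʳ (symbTerm t) (here refl)
    swap x t (there z∈)  = ∈-++⁺ˡ z∈

  symb-projA : ∀ ℓ (π : Projectable (atomOf ℓ)) {z} → z ∈ symb (projA ℓ π) →
               z ∈ symbLiteral ℓ ⊎ z ∈ auxVars ℓ π
  symb-projA ℓ@(_ , _) (a-local _) z∈ = inj₁ (subst (_ ∈_) (symb-literal ℓ) z∈)
  symb-projA ℓ@(_ , _) (shared _)  z∈ = inj₁ (go style z∈)
    where
    go : ∀ st {z} → z ∈ symb (shared↓A st ℓ) → z ∈ symbLiteral ℓ
    go pudlák z∈ = subst (_ ∈_) (symb-literal ℓ) z∈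
  symb-projA (Sign.+ , _) (mixed-≈ {a = a} {b} _ _)  = symb-eq a b
  symb-projA (Sign.- , _) (mixed-≈ {a = a} {b} _ _)  = symb-xor (symb-eq a b)
  symb-projA (Sign.+ , _) (mixed-≈˘ {a = a} {b} _ _) = symb-eq˘ a b
  symb-projA (Sign.- , _) (mixed-≈˘ {a = a} {b} _ _) = symb-xor (symb-eq˘ a b)
  symb-projA (Sign.+ , _) (mixed-≤ m) {z} z∈ =
    ∈-++-elim (symbLin (MixedSplit.a m)) (inj₁ ∘ interleaving-left (MixedSplit.split m)) inj₂
      (subst (z ∈_) (symb-++ (MixedSplit.a m) _) z∈)
  symb-projA (Sign.- , _) (mixed-≤ m) {z} z∈ =
    ∈-++-elim (symbLin (MixedSplit.a m)) (inj₁ ∘ interleaving-left (MixedSplit.split m)) inj₂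
      (subst (z ∈_) (trans (symb-++ (-ˡ MixedSplit.a m) _)
                           (cong (_++ _) (symb-· _ (MixedSplit.a m)))) z∈)

  symb-projB : ∀ ℓ (π : Projectable (atomOf ℓ)) {z} → z ∈ symb (projB ℓ π) →
               z ∈ symbLiteral ℓ ⊎ z ∈ auxVars ℓ π
  symb-projB ℓ@(_ , _) (b-local _) z∈ = inj₁ (subst (_ ∈_) (symb-literal ℓ) z∈)
  symb-projB ℓ@(_ , _) (shared _)  z∈ = inj₁ (subst (_ ∈_) (symb-literal ℓ) z∈)
  symb-projB (Sign.+ , _) (mixed-≈ {a = a} {b} _ _)  = symb-eq˘ b a ∘ swap _ b
  symb-projB (Sign.- , _) (mixed-≈ {a = a} {b} _ _)  = symb-xor (symb-eq˘ b a ∘ swap _ b)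
  symb-projB (Sign.+ , _) (mixed-≈˘ {a = a} {b} _ _) = symb-eq b a ∘ swap _ b
  symb-projB (Sign.- , _) (mixed-≈˘ {a = a} {b} _ _) = symb-xor (symb-eq b a ∘ swap _ b)
  symb-projB (Sign.+ , _) (mixed-≤ m) (here refl)  = inj₂ (here refl)
  symb-projB (Sign.+ , _) (mixed-≤ m) (there z∈) =
    inj₁ (interleaving-right (MixedSplit.split m) z∈)
  symb-projB (Sign.- , _) (mixed-≤ m) (here refl)  = inj₂ (here refl)
  symb-projB (Sign.- , _) (mixed-≤ m) (there z∈) =
    inj₁ (interleaving-right (MixedSplit.split m) z∈)

  symb-¬projA : ∀ {C} (K : ProjectableClause C) {z} → z ∈ symb (¬projA K) →
                z ∈ symbClause C ⊎ z ∈ ¬auxVars K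
  symb-¬projA {ℓ ∷ C} (π ∷ K) = ∈-++-elim (symb (projA (negate ℓ) π))
    (Sum.map ∈-++⁺ˡ ∈-++⁺ˡ ∘ symb-projA (negate ℓ) π)
    (Sum.map (∈-++⁺ʳ (symbLiteral ℓ)) (∈-++⁺ʳ (auxVars (negate ℓ) π)) ∘ symb-¬projA K)

  symb-¬projB : ∀ {C} (K : ProjectableClause C) {z} → z ∈ symb (¬projB K) →
                z ∈ symbClause C ⊎ z ∈ ¬auxVars K
  symb-¬projB {ℓ ∷ C} (π ∷ K) = ∈-++-elim (symb (projB (negate ℓ) π))
    (Sum.map ∈-++⁺ˡ ∈-++⁺ˡ ∘ symb-projB (negate ℓ) π)
    (Sum.map (∈-++⁺ʳ (symbLiteral ℓ)) (∈-++⁺ʳ (auxVars (negate ℓ) π)) ∘ symb-¬projB K)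

  -- The auxiliary variable of a mixed inequality belongs to no other literal.
  ineq-aux-unique : ∀ {τ} σ (L : Lin τ) c ℓ (π : Projectable (atomOf ℓ)) →
                    auxSymbol (ineq (opposite σ) L c) ∈ auxVars (negate ℓ) π → (σ , (L ≤ c)) ≡ ℓ
  ineq-aux-unique Sign.+ L c (Sign.+ , _) (mixed-≤ {L = L′} {c′} _) (here e)
    with refl ← distinct {ineq Sign.- L c} {ineq Sign.- L′ c′} e = refl
  ineq-aux-unique Sign.- L c (Sign.- , _) (mixed-≤ {L = L′} {c′} _) (here e)
    with refl ← distinct {ineq Sign.+ L c} {ineq Sign.+ L′ c′} e = refl
  ineq-aux-unique Sign.+ L c (Sign.- , _) (mixed-≤ {L = L′} {c′} _) (here e)
    with () ← distinct {ineq Sign.- L c} {ineq Sign.+ L′ c′} e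
  ineq-aux-unique Sign.- L c (Sign.+ , _) (mixed-≤ {L = L′} {c′} _) (here e)
    with () ← distinct {ineq Sign.+ L c} {ineq Sign.- L′ c′} e
  ineq-aux-unique σ L c (Sign.- , _) (mixed-≈ {a = a} {b} _ _) (here e)
    with () ← distinct {ineq (opposite σ) L c} {eq a b} e
  ineq-aux-unique σ L c (Sign.+ , _) (mixed-≈ {a = a} {b} _ _) (here e)
    with () ← distinct {ineq (opposite σ) L c} {eq a b} e
  ineq-aux-unique σ L c (Sign.- , _) (mixed-≈˘ {a = a} {b} _ _) (here e)
    with () ← distinct {ineq (opposite σ) L c} {eq a b} e
  ineq-aux-unique σ L c (Sign.+ , _) (mixed-≈˘ {a = a} {b} _ _) (here e)
    with () ← distinct {ineq (opposite σ) L c} {eq a b} e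
  ineq-aux-unique σ L c (Sign.+ , _) (mixed-≈ {a = a} {b} _ _) (there (here e))
    with () ← distinct {ineq (opposite σ) L c} {bool a b} e
  ineq-aux-unique σ L c (Sign.+ , _) (mixed-≈˘ {a = a} {b} _ _) (there (here e))
    with () ← distinct {ineq (opposite σ) L c} {bool a b} e

  ineq-aux∉¬auxVars : ∀ {τ} σ (L : Lin τ) c {C} (K : ProjectableClause C) →
                      (σ , (L ≤ c)) ∉ C → auxSymbol (ineq (opposite σ) L c) ∉ ¬auxVars K
  ineq-aux∉¬auxVars σ L c {ℓ ∷ C} (π ∷ K) ∉C = ∈-++-elim (auxVars (negate ℓ) π)
    (λ x∈ → ∉C (here (ineq-aux-unique σ L c ℓ π x∈)))
    (ineq-aux∉¬auxVars σ L c K (∉C ∘ there))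

  ¬projA-++ : ∀ M {C D} (K : ProjectableClause C) {J : ProjectableClause D} →
              M ⊨ᶠ ¬projA (++⁺ K J) → M ⊨ᶠ ¬projA K × M ⊨ᶠ ¬projA J
  ¬projA-++ M []      j       = tt , j
  ¬projA-++ M (π ∷ K) (p , r) = let k , j = ¬projA-++ M K r in (p , k) , j

  ¬projB-++ : ∀ M {C D} (K : ProjectableClause C) {J : ProjectableClause D} →
              M ⊨ᶠ ¬projB (++⁺ K J) → M ⊨ᶠ ¬projB K × M ⊨ᶠ ¬projB J
  ¬projB-++ M []      j       = tt , j
  ¬projB-++ M (π ∷ K) (p , r) = let k , j = ¬projB-++ M K r in (p , k) , j

  ∈-¬auxVars-++ : ∀ {C D} (K : ProjectableClause C) (J : ProjectableClause D) {z} →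
                  z ∈ ¬auxVars K ⊎ z ∈ ¬auxVars J → z ∈ ¬auxVars (++⁺ K J)
  ∈-¬auxVars-++ []                  J (inj₂ z∈) = z∈
  ∈-¬auxVars-++ (_∷_ {x = ℓ} π K) J (inj₁ z∈) = ∈-++-elim (auxVars (negate ℓ) π)
    ∈-++⁺ˡ (∈-++⁺ʳ (auxVars (negate ℓ) π) ∘ ∈-¬auxVars-++ K J ∘ inj₁) z∈
  ∈-¬auxVars-++ (_∷_ {x = ℓ} π K) J (inj₂ z∈) =
    ∈-++⁺ʳ (auxVars (negate ℓ) π) (∈-¬auxVars-++ K J (inj₂ z∈))

  -- A premise of the resolution step: a partial interpolant of the clause C extended
  -- by the mixed inequality L ≤ c or its negation.
  module Premise
    {τ : Num} (σ : Sign) (L : Lin τ) (c : Bound τ) (mixed : MixedSplit L)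
    {C : Clause} (K : ProjectableClause C) (ℓ∉C : (σ , (L ≤ c)) ∉ C)
    (x∉A : auxSymbol (ineq (opposite σ) L c) ∉ symb A)
    (x∉B : auxSymbol (ineq (opposite σ) L c) ∉ symb B)
    (x∉L : auxSymbol (ineq (opposite σ) L c) ∉ symbLin L)
    (x∉C : auxSymbol (ineq (opposite σ) L c) ∉ symbClause C)
    {J : Context} {coeff : Pos τ} {s : LATerm τ} {k : Slack τ} {F : Body}
    (hole : nothing ∈ leaves J)
    (x∉s : name (ineq (opposite σ) L c) ∉ names s)
    (x∉J : auxSymbol (ineq (opposite σ) L c) ∉ symbContext J)
    (premise : PartialInterpolant {(σ , (L ≤ c)) ∷ C} (mixed-≤ mixed ∷ K)
                 (J [ leaf (LA (coeff ·ᵖ name (ineq (opposite σ) L c) +ᴾ s) k F) ])) where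

    open PartialInterpolant premise public
    open MixedSplit mixed using (a; b; split)

    x : ℕ
    x = name (ineq (opposite σ) L c)

    P : LAPattern
    P = LA (coeff ·ᵖ x +ᴾ s) k F

    wf : WellFormed P
    wf = patterns (leaves-fill⁺ J hole (here refl))

    open WellFormedPatterns.Variable aux wf x∉s public

    private
      ℓ : Literal
      ℓ = σ , (L ≤ c)

      x∉K : auxSymbol (ineq (opposite σ) L c) ∉ ¬auxVars K
      x∉K = ineq-aux∉¬auxVars σ L c K ℓ∉C

      x∉a : auxSymbol (ineq (opposite σ) L c) ∉ symbLin a
      x∉a = x∉L ∘ interleaving-left split

      x∉b : auxSymbol (ineq (opposite σ) L c) ∉ symbLin b
      x∉b = x∉L ∘ interleaving-right split

    implied-at : ∀ M v → M ⊨ᶠ A → M ⊨ᶠ ¬projA K →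
                 M [ x ∶ τ ≔ v ] ⊨ᶠ ineq↓A (opposite σ) L c mixed →
                 M [ x ∶ τ ≔ v ] ⊨ᶠ formulaLA (J [ leaf P ])
    implied-at M v ⊨A ⊨K ⊨pivot = implied (M [ x ∶ τ ≔ v ])
      ( subst id (sym (Update.update-formula M x v A x∉A)) ⊨A
      , ⊨pivot
      , subst id (sym (Update.update-formula M x v (¬projA K)
          (Sum.[ x∉C , x∉K ]′ ∘ symb-¬projA K))) ⊨K )

    inconsistent-at : ∀ M v → M ⊨ᶠ B → M ⊨ᶠ ¬projB K →
                      M [ x ∶ τ ≔ v ] ⊨ᶠ ineq↓B (opposite σ) L c mixed →
                      ¬ (M [ x ∶ τ ≔ v ] ⊨ᶠ formulaLA (J [ leaf P ]))
    inconsistent-at M v ⊨B ⊨K ⊨pivot ⊨I = inconsistent (M [ x ∶ τ ≔ v ])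
      ( subst id (sym (Update.update-formula M x v B x∉B)) ⊨B
      , ( ⊨pivot
        , subst id (sym (Update.update-formula M x v (¬projB K)
            (Sum.[ x∉C , x∉K ]′ ∘ symb-¬projB K))) ⊨K )
      , ⊨I )

    at-x : ∀ M v → ⟦ M [ x ∶ τ ≔ v ] ⟧ {num τ} ⟨ x ⟩ ≡ v
    at-x M v = assign-here M τ (x ∷ []) (λ _ → v) (here refl)

    eval-b : ∀ M d v → ⟦ M [ x ∶ τ ≔ v ] ⟧ˡ ((d , ⟨ x ⟩) ∷ b) ≡ (d *ᵛ v) +ᵛ ⟦ M ⟧ˡ b
    eval-b M d v = cong₂ (λ u w → (d *ᵛ u) +ᵛ w) (at-x M v) (Update.update-lin M x v b x∉b)

    eval-a+x : ∀ M v → ⟦ M [ x ∶ τ ≔ v ] ⟧ˡ (a ++ (1ᵛ , ⟨ x ⟩) ∷ []) ≡ ⟦ M ⟧ˡ a +ᵛ v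
    eval-a+x M v = trans (Evaluation.eval-++ (M [ x ∶ τ ≔ v ]) a _)
      (cong₂ _+ᵛ_ (Update.update-lin M x v a x∉a)
        (trans (+ᵛ-identityʳ _) (trans (*ᵛ-identityˡ _) (at-x M v))))

    eval-neg-a+x : ∀ M v →
      ⟦ M [ x ∶ τ ≔ v ] ⟧ˡ ((-ˡ a) ++ (1ᵛ , ⟨ x ⟩) ∷ []) ≡ (-ᵛ ⟦ M ⟧ˡ a) +ᵛ v
    eval-neg-a+x M v = trans (Evaluation.eval-++ (M [ x ∶ τ ≔ v ]) (-ˡ a) _)
      (cong₂ _+ᵛ_
        (trans (Evaluation.eval-neg (M [ x ∶ τ ≔ v ]) a) (cong -ᵛ_ (Update.update-lin M x v a x∉a)))
        (trans (+ᵛ-identityʳ _) (trans (*ᵛ-identityˡ _) (at-x M v))))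

    -- As x does not occur in the context, truth of a formula in context passes between
    -- M and its update at x as soon as this is so for the contents of the hole.
    fill-from-update : ∀ M v {G H} →
      (M [ x ∶ τ ≔ v ] ⊨ᶠ formulaLA G → M ⊨ᶠ formulaLA H) →
      M [ x ∶ τ ≔ v ] ⊨ᶠ formulaLA (J [ G ]) → M ⊨ᶠ formulaLA (J [ H ])
    fill-from-update M v {G} {H} =
      fill-mono M (Structure.funᴵ (M [ x ∶ τ ≔ v ])) (Structure.funᴵ M) J {G} {H}
        λ z∈ → Update.agree-≢ M x v λ { refl → x∉J z∈ }

    fill-to-update : ∀ M v {G H} →
      (M ⊨ᶠ formulaLA G → M [ x ∶ τ ≔ v ] ⊨ᶠ formulaLA H) →
      M ⊨ᶠ formulaLA (J [ G ]) → M [ x ∶ τ ≔ v ] ⊨ᶠ formulaLA (J [ H ])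
    fill-to-update M v {G} {H} =
      fill-mono M (Structure.funᴵ M) (Structure.funᴵ (M [ x ∶ τ ≔ v ])) J {G} {H}
        λ {z} z∈ → agree-sym M z (Update.agree-≢ M x v λ { refl → x∉J z∈ })

    vocabulary-≢ : ∀ {z} → z ∈ symbLA (J [ leaf P ]) → z ≢ var (num τ) x →
                   SharedSymbol z ⊎ z ∈ ¬auxVars K
    vocabulary-≢ z∈ z≢x with vocabulary z∈
    ... | inj₁ z-shared          = inj₁ z-shared
    ... | inj₂ (here z≡x)        = contradiction z≡x z≢x
    ... | inj₂ (there z∈K)       = inj₂ z∈K

    context-vocabulary : ∀ {z} → z ∈ symbContext J → SharedSymbol z ⊎ z ∈ ¬auxVars K
    context-vocabulary z∈ = vocabulary-≢ (symbContext-fill⁺ J z∈) λ { refl → x∉J z∈ }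

    linLA-vocabulary : ∀ {z} → z ∈ symbLin (linLA s) → SharedSymbol z ⊎ z ∈ ¬auxVars K
    linLA-vocabulary z∈ = vocabulary-≢ (symbHole-fill⁺ J hole (there (∈-++⁺ˡ z∈)))
      λ { refl → x∉linLA z∈ }

    F-vocabulary : ∀ {z} → z ∈ symbLits F → z ≢ var (num τ) x → SharedSymbol z ⊎ z ∈ ¬auxVars K
    F-vocabulary z∈ = vocabulary-≢ (symbHole-fill⁺ J hole (there (∈-++⁺ʳ (symbLin (linLA s)) z∈)))

-- The resolution step

module _ (aux : AuxNaming) where
  open AuxNaming aux
  open WellFormedPatterns aux

  -- LA(s₃, k₃, F₃) satisfies the conditions on an LA-pattern.
  resolvent-wellFormed :
    ∀ {τ} {c₁ c₂ : Pos τ} {s₁ s₂ : LATerm τ} {k₁ k₂ : Slack τ} {x₁ x₂ : ℕ} {F₁ F₂ : Body} →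
    WellFormed (LA (c₁ ·ᵖ x₁ +ᴾ s₁) k₁ F₁) → x₁ ∉ names s₁ →
    WellFormed (LA (c₂ ·ᵖ x₂ +ᴾ s₂) k₂ F₂) → x₂ ∉ names s₂ →
    WellFormed (LA (s₃ c₁ c₂ s₁ s₂) (k₃ c₁ c₂ k₁ k₂) (F₃ c₁ c₂ s₁ s₂ k₁ x₁ x₂ F₁ F₂))
  resolvent-wellFormed {τ} {c₁} {c₂} {s₁} {s₂} {k₁} {k₂} {x₁} {x₂} {F₁} {F₂}
                       wf₁ x₁∉s₁ wf₂ x₂∉s₂ = record
    { aux-vars    = aux-vars₃
    ; others-free = λ z∈ → ∈-++-elim (symbLin (others s₁)) W₁.others-free W₂.others-free
                      (subst (_ ∈_) (symb-others-s₃ c₁ c₂ s₁ s₂) z∈)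
    ; F-vars      = λ z∈ z-aux → ∈-names-s₃ c₁ c₂ s₁ s₂
                      (F-vars₃ z-aux (symb-F₃ c₁ c₂ s₁ s₂ k₁ x₁ x₂ F₁ F₂ z∈))
    ; slack       = k₃-valid c₁ c₂ k₁ k₂ W₁.slack W₂.slack
    ; monotone    = monotone₃
    ; F-⊥         = λ M 0<s₃ ⊨F₃ → witness⇒s₃≤0 (V₁.profile M) (V₂.profile M) (split M ⊨F₃)
                      (subst (0ᵛ <ᵛ_) (Evaluation.eval-s₃ M c₁ c₂ s₁ s₂) 0<s₃)
    ; F-⊤         = λ M s₃<-k₃ → join M (s₃<-k₃⇒witness (V₁.profile M) (V₂.profile M)
                      (subst (_<- k₃ c₁ c₂ k₁ k₂) (Evaluation.eval-s₃ M c₁ c₂ s₁ s₂) s₃<-k₃))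
    }
    where
    module W₁ = WellFormed wf₁
    module W₂ = WellFormed wf₂
    module V₁ = Variable wf₁ x₁∉s₁
    module V₂ = Variable wf₂ x₂∉s₂
    ys = names (s₃ c₁ c₂ s₁ s₂)

    ⊨F₃ : Structure → Set
    ⊨F₃ M = M ⊨ᶠ formulaBody (F₃ c₁ c₂ s₁ s₂ k₁ x₁ x₂ F₁ F₂)

    split : ∀ M → ⊨F₃ M → Witness {τ} (Holds M x₁ F₁) (Holds M x₂ F₂)
    split M = F₃⇒witness M (V₁.profile M) (V₂.profile M)

    join : ∀ M → Witness {τ} (Holds M x₁ F₁) (Holds M x₂ F₂) → ⊨F₃ M
    join M = witness⇒F₃ M (V₁.profile M) (V₂.profile M) W₁.slack

    aux-vars₃ : All (λ y → IneqAux (var (num τ) y)) ys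
    aux-vars₃ = subst (All _) (sym (names-s₃ c₁ c₂ s₁ s₂))
      (++⁺ (All.tail W₁.aux-vars) (All.tail W₂.aux-vars))

    ∈-tail : ∀ {x z : Symbol} {zs} → z ≢ x → z ∈ x ∷ zs → z ∈ zs
    ∈-tail z≢x (here z≡x)  = contradiction z≡x z≢x
    ∈-tail z≢x (there z∈) = z∈

    linLA-aux : ∀ s {z} → (∀ {z} → z ∈ symbLin (others s) → ¬ IneqAux z) → IneqAux z →
                z ∈ symbLin (linLA s) → z ∈ map (var (num τ)) (names s)
    linLA-aux s free z-aux z∈ with linLA-cases s z∈
    ... | inj₁ z∈names  = z∈names
    ... | inj₂ z∈others = contradiction z-aux (free z∈others)

    F-vars₃ : ∀ {z} → IneqAux z → ResolventSymbol s₁ s₂ x₁ x₂ F₁ F₂ z →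
              z ∈ map (var (num τ)) (names s₁) ⊎ z ∈ map (var (num τ)) (names s₂)
    F-vars₃ z-aux (from-F₁ z∈F₁ z≢x₁) = inj₁ (∈-tail z≢x₁ (W₁.F-vars z∈F₁ z-aux))
    F-vars₃ z-aux (from-F₂ z∈F₂ z≢x₂) = inj₂ (∈-tail z≢x₂ (W₂.F-vars z∈F₂ z-aux))
    F-vars₃ z-aux (from-s₁ z∈s₁)      = inj₁ (linLA-aux s₁ W₁.others-free z-aux z∈s₁)
    F-vars₃ z-aux (from-s₂ z∈s₂)      = inj₂ (linLA-aux s₂ W₂.others-free z-aux z∈s₂)

    not-assigned : ∀ {x s k F c} → WellFormed (LA (c ·ᵖ x +ᴾ s) k F) →
                   ∀ {z} → z ∈ symbLits F → z ∉ map (var (num τ)) (x ∷ names s) →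
                   z ∉ map (var (num τ)) ys
    not-assigned wf z∈F z∉ z∈ys with ∈-map⁻ (var (num τ)) z∈ys
    ... | y , y∈ys , refl = z∉ (WellFormed.F-vars wf z∈F (All.lookup aux-vars₃ y∈ys))

    ys⊇₁ : ∀ {y} → y ∈ names s₁ → y ∈ ys
    ys⊇₁ y∈ = subst (_ ∈_) (sym (names-s₃ c₁ c₂ s₁ s₂)) (∈-++⁺ˡ y∈)

    ys⊇₂ : ∀ {y} → y ∈ names s₂ → y ∈ ys
    ys⊇₂ y∈ = subst (_ ∈_) (sym (names-s₃ c₁ c₂ s₁ s₂)) (∈-++⁺ʳ (names s₁) y∈)

    -- The witness for ρ is also one for ρ′.
    monotone₃ : ∀ M (ρ ρ′ : ℕ → Val τ) → (∀ {y} → y ∈ ys → ρ′ y ≤ᵛ ρ y) →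
                ⊨F₃ (assign M τ ys ρ) → ⊨F₃ (assign M τ ys ρ′)
    monotone₃ M ρ ρ′ ρ′≤ρ ⊨ρ =
      let v , F₁v , F₂-v = split (assign M τ ys ρ) ⊨ρ in
      join (assign M τ ys ρ′)
        ( v
        , V₁.lower-others M g h v v ≤ᵛ-refl (h≤g ∘ ys⊇₁)
            (λ {z} z∈F z∉ → unchanged z (not-assigned wf₁ z∈F z∉)) F₁v
        , V₂.lower-others M g h (-ᵛ v) (-ᵛ v) ≤ᵛ-refl (h≤g ∘ ys⊇₂)
            (λ {z} z∈F z∉ → unchanged z (not-assigned wf₂ z∈F z∉)) F₂-v )
      where
      g h : InterpretationOf M
      g = Structure.funᴵ (assign M τ ys ρ)
      h = Structure.funᴵ (assign M τ ys ρ′)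
      h≤g : ∀ {y} → y ∈ ys → h y [] (num τ) [] ≤ᵛ g y [] (num τ) []
      h≤g y∈ = subst₂ _≤ᵛ_ (sym (assign-here M τ ys ρ′ y∈)) (sym (assign-here M τ ys ρ y∈)) (ρ′≤ρ y∈)
      unchanged : ∀ z → z ∉ map (var (num τ)) ys → AgreeAt M g h z
      unchanged z z∉ = agree-trans M z (assign-elsewhere M τ ys ρ z∉)
        (agree-sym M z (assign-elsewhere M τ ys ρ′ z∉))

theorem3 : ∀ (style : Style) (problem : InterpolationProblem) (aux : AuxNaming) →
    let open Interpolation style problem aux
        open AuxNaming aux in
    ∀ {τ} (a+b : Lin τ) (c : Bound τ) (mixed : MixedSplit a+b) →
    let a+b≤c    = Sign.+ , (a+b ≤ c)
        ¬[a+b≤c] = negate a+b≤c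
        x₂       = name (ineq Sign.+ a+b c)
        x₁       = name (ineq Sign.- a+b c) in
    ∀ (C₁ C₂ : Clause) (K₁ : ProjectableClause C₁) (K₂ : ProjectableClause C₂) →
    a+b≤c ∉ C₁ → ¬[a+b≤c] ∉ C₁ → a+b≤c ∉ C₂ → ¬[a+b≤c] ∉ C₂ →
    Fresh (a+b≤c ∷ C₁ ++ C₂) →
    ∀ (I₁ I₂ : Context) (c₁ c₂ : Pos τ) (s₁ s₂ : LATerm τ) (k₁ k₂ : Slack τ) (F₁ F₂ : Body) →
    nothing ∈ leaves I₁ → nothing ∈ leaves I₂ →
    x₁ ∉ names s₁ → x₂ ∉ names s₂ →
    var (num τ) x₁ ∉ symbContext I₁ → var (num τ) x₂ ∉ symbContext I₂ →
    PartialInterpolant {a+b≤c ∷ C₁} (mixed-≤ mixed ∷ K₁)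
      (I₁ [ leaf (LA (c₁ ·ᵖ x₁ +ᴾ s₁) k₁ F₁) ]) →
    PartialInterpolant {¬[a+b≤c] ∷ C₂} (mixed-≤ mixed ∷ K₂)
      (I₂ [ leaf (LA (c₂ ·ᵖ x₂ +ᴾ s₂) k₂ F₂) ]) →
    PartialInterpolant {C₁ ++ C₂} (++⁺ K₁ K₂)
      (I₁ [ I₂ [ leaf (LA (s₃ c₁ c₂ s₁ s₂) (k₃ c₁ c₂ k₁ k₂) (F₃ c₁ c₂ s₁ s₂ k₁ x₁ x₂ F₁ F₂)) ] ])
theorem3 style problem aux {τ} a+b c mixed C₁ C₂ K₁ K₂ a+b≤c∉C₁ _ _ ¬[a+b≤c]∉C₂ fresh
  I₁ I₂ c₁ c₂ s₁ s₂ k₁ k₂ F₁ F₂ hole₁ hole₂ x₁∉s₁ x₂∉s₂ x₁∉I₁ x₂∉I₂ interpolant₁ interpolant₂ =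
  record
    { implied      = implied₃
    ; inconsistent = inconsistent₃
    ; vocabulary   = vocabulary₃
    ; patterns     = patterns₃
    ; only-in-LA   = only-in-LA₃
    }
  where
  open InterpolationProblem problem
  open AuxNaming aux
  open Interpolation style problem aux
  open Projection style problem aux

  κ₁ κ₂ : AuxKey
  κ₁ = ineq Sign.- a+b c
  κ₂ = ineq Sign.+ a+b c

  fresh-a+b : ∀ κ → auxSymbol κ ∉ symbLin a+b
  fresh-a+b κ = proj₂ (proj₂ (fresh κ)) ∘ ∈-++⁺ˡ

  fresh-C : ∀ κ → auxSymbol κ ∉ symbClause (C₁ ++ C₂)
  fresh-C κ = proj₂ (proj₂ (fresh κ)) ∘ ∈-++⁺ʳ (symbLin a+b)

  fresh-C₁ : ∀ κ → auxSymbol κ ∉ symbClause C₁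
  fresh-C₁ κ = fresh-C κ ∘ subst (_ ∈_) (sym (List.concatMap-++ symbLiteral C₁ C₂)) ∘ ∈-++⁺ˡ

  fresh-C₂ : ∀ κ → auxSymbol κ ∉ symbClause C₂
  fresh-C₂ κ = fresh-C κ ∘ subst (_ ∈_) (sym (List.concatMap-++ symbLiteral C₁ C₂)) ∘
    ∈-++⁺ʳ (symbClause C₁)

  module P₁ = Premise Sign.+ a+b c mixed K₁ a+b≤c∉C₁
    (proj₁ (fresh κ₁)) (proj₁ (proj₂ (fresh κ₁))) (fresh-a+b κ₁) (fresh-C₁ κ₁)
    {I₁} {c₁} {s₁} {k₁} {F₁} hole₁ x₁∉s₁ x₁∉I₁ interpolant₁
  module P₂ = Premise Sign.- a+b c mixed K₂ ¬[a+b≤c]∉C₂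
    (proj₁ (fresh κ₂)) (proj₁ (proj₂ (fresh κ₂))) (fresh-a+b κ₂) (fresh-C₂ κ₂)
    {I₂} {c₂} {s₂} {k₂} {F₂} hole₂ x₂∉s₂ x₂∉I₂ interpolant₂

  open MixedSplit mixed using (a; b)

  P₃ : LAPattern
  P₃ = LA (s₃ c₁ c₂ s₁ s₂) (k₃ c₁ c₂ k₁ k₂) (F₃ c₁ c₂ s₁ s₂ k₁ P₁.x P₂.x F₁ F₂)

  -- At x₁ = v and x₂ = -v for the value v of a, both projections of the pivot read 0 ≤ 0.
  implied₃ : (A ∧ ¬projA (++⁺ K₁ K₂)) ⊨ formulaLA (I₁ [ I₂ [ leaf P₃ ] ])
  implied₃ M (⊨A , ⊨K) =
    P₁.fill-from-update M v {leaf P₁.P} {I₂ [ leaf P₃ ]}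
      (λ F₁v → P₂.fill-from-update M (-ᵛ v) {leaf P₂.P} {leaf P₃}
        (λ F₂-v → witness⇒F₃ M (P₁.profile M) (P₂.profile M) (WellFormed.slack P₁.wf)
                    (v , F₁v , F₂-v))
        (P₂.implied-at M (-ᵛ v) ⊨A (proj₂ ⊨K₁₂)
          (subst (_≤ᵇ 0ᵇ)
            (sym (trans (P₂.eval-a+x M (-ᵛ v)) (trans (+ᵛ-comm v (-ᵛ v)) (-ᵛ-inverseˡ v))))
            0≤ᵇ0)))
      (P₁.implied-at M v ⊨A (proj₁ ⊨K₁₂)
        (subst (_≤ᵇ 0ᵇ) (sym (trans (P₁.eval-neg-a+x M v) (-ᵛ-inverseˡ v))) 0≤ᵇ0))
    where
    v = ⟦ M ⟧ˡ a
    ⊨K₁₂ = ¬projA-++ M K₁ ⊨K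

  inconsistent₃ : (B ∧ ¬projB (++⁺ K₁ K₂) ∧ formulaLA (I₁ [ I₂ [ leaf P₃ ] ])) ⊨ ⊥ᶠ
  inconsistent₃ M (⊨B , ⊨K , ⊨I) = ¬¬⊨I₂ λ ⊨I₂ → ¬¬⊨F₃ ⊨I₂ λ ⊨F₃ →
    decide ⊨I₂ (F₃⇒witness M (P₁.profile M) (P₂.profile M) ⊨F₃)
    where
    β = ⟦ M ⟧ˡ b
    ⊨K₁₂ = ¬projB-++ M K₁ ⊨K

    refute₁ : ∀ v → ¬ ((v +ᵛ β) ≤ᵇ c) →
              (M ⊨ᶠ formulaLA (I₂ [ leaf P₃ ]) → Holds M P₁.x F₁ v) → ⊥
    refute₁ v v+β≰c I₂⇒F₁ = P₁.inconsistent-at M v ⊨B (proj₁ ⊨K₁₂)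
      (subst (λ w → ¬ (w ≤ᵇ c))
        (sym (trans (P₁.eval-b M 1ᵛ v) (cong (_+ᵛ β) (*ᵛ-identityˡ v)))) v+β≰c)
      (P₁.fill-to-update M v {I₂ [ leaf P₃ ]} {leaf P₁.P} I₂⇒F₁ ⊨I)

    refute₂ : M ⊨ᶠ formulaLA (I₂ [ leaf P₃ ]) → ∀ v → (v +ᵛ β) ≤ᵇ c →
              (M ⊨ᶠ formulaLA (leaf P₃) → Holds M P₂.x F₂ (-ᵛ v)) → ⊥
    refute₂ ⊨I₂ v v+β≤c F₃⇒F₂ = P₂.inconsistent-at M (-ᵛ v) ⊨B (proj₂ ⊨K₁₂)
      (subst (_≤ᵇ c)
        (sym (trans (P₂.eval-b M (-ᵛ 1ᵛ) (-ᵛ v))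
                    (cong (_+ᵛ β) (trans (-1*ᵛ (-ᵛ v)) (-ᵛ-involutive v))))) v+β≤c)
      (P₂.fill-to-update M (-ᵛ v) {leaf P₃} {leaf P₂.P} F₃⇒F₂ ⊨I₂)

    -- A false formula in the hole may be replaced by any other, F₁(v) included, so that
    -- any v that satisfies the projection of the pivot gives the contradiction.
    ¬¬⊨I₂ : ¬ ¬ (M ⊨ᶠ formulaLA (I₂ [ leaf P₃ ]))
    ¬¬⊨I₂ ⊭I₂ = let v , v+β≰c = ∃-≰ᵇ β c in refute₁ v v+β≰c (⊥-elim ∘ ⊭I₂)

    ¬¬⊨F₃ : M ⊨ᶠ formulaLA (I₂ [ leaf P₃ ]) → ¬ ¬ (M ⊨ᶠ formulaLA (leaf P₃))
    ¬¬⊨F₃ ⊨I₂ ⊭F₃ = let v , v+β≤c = ∃-≤ᵇ β c in refute₂ ⊨I₂ v v+β≤c (⊥-elim ∘ ⊭F₃)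

    decide : M ⊨ᶠ formulaLA (I₂ [ leaf P₃ ]) →
             Witness {τ} (Holds M P₁.x F₁) (Holds M P₂.x F₂) → ⊥
    decide ⊨I₂ (v , F₁v , F₂-v) with (v +ᵛ β) ≤ᵇ? c
    ... | yes v+β≤c = refute₂ ⊨I₂ v v+β≤c (λ _ → F₂-v)
    ... | no v+β≰c  = refute₁ v v+β≰c (λ _ → F₁v)

  vocabulary-left : ∀ {z} → SharedSymbol z ⊎ z ∈ ¬auxVars K₁ →
                    SharedSymbol z ⊎ z ∈ ¬auxVars (++⁺ K₁ K₂)
  vocabulary-left = Sum.map₂ (∈-¬auxVars-++ K₁ K₂ ∘ inj₁)

  vocabulary-right : ∀ {z} → SharedSymbol z ⊎ z ∈ ¬auxVars K₂ →
                     SharedSymbol z ⊎ z ∈ ¬auxVars (++⁺ K₁ K₂)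
  vocabulary-right = Sum.map₂ (∈-¬auxVars-++ K₁ K₂ ∘ inj₂)

  vocabulary₃ : ∀ {z} → z ∈ symbLA (I₁ [ I₂ [ leaf P₃ ] ]) →
                SharedSymbol z ⊎ z ∈ ¬auxVars (++⁺ K₁ K₂)
  vocabulary₃ {z} z∈ with symbLA-fill⁻ I₁ z∈
  ... | inj₁ z∈I₁ = vocabulary-left (P₁.context-vocabulary z∈I₁)
  ... | inj₂ z∈′ with symbLA-fill⁻ I₂ {leaf P₃} z∈′
  ...   | inj₁ z∈I₂ = vocabulary-right (P₂.context-vocabulary z∈I₂)
  ...   | inj₂ z∈P₃ = ∈-++-elim (symbLin (linLA (s₃ c₁ c₂ s₁ s₂)))
          (Sum.[ vocabulary-left ∘ P₁.linLA-vocabulary , vocabulary-right ∘ P₂.linLA-vocabulary ]′ ∘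
            symb-s₃ c₁ c₂ s₁ s₂)
          (from-F₃ ∘ symb-F₃ c₁ c₂ s₁ s₂ k₁ P₁.x P₂.x F₁ F₂)
          (subst (_ ∈_) (List.++-identityʳ (symbLAPattern P₃)) z∈P₃)
    where
    from-F₃ : ResolventSymbol s₁ s₂ P₁.x P₂.x F₁ F₂ z →
              SharedSymbol z ⊎ z ∈ ¬auxVars (++⁺ K₁ K₂)
    from-F₃ (from-F₁ z∈F₁ z≢x₁) = vocabulary-left (P₁.F-vocabulary z∈F₁ z≢x₁)
    from-F₃ (from-F₂ z∈F₂ z≢x₂) = vocabulary-right (P₂.F-vocabulary z∈F₂ z≢x₂)
    from-F₃ (from-s₁ z∈s₁)      = vocabulary-left (P₁.linLA-vocabulary z∈s₁)
    from-F₃ (from-s₂ z∈s₂)      = vocabulary-right (P₂.linLA-vocabulary z∈s₂)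

  patterns₃ : ∀ {P} → P ∈ leaves (I₁ [ I₂ [ leaf P₃ ] ]) → WellFormed P
  patterns₃ P∈ with leaves-fill⁻ I₁ P∈
  ... | inj₁ P∈I₁ = P₁.patterns (leaves-fill⁺ I₁ P∈I₁ (here refl))
  ... | inj₂ P∈′ with leaves-fill⁻ I₂ P∈′
  ...   | inj₁ P∈I₂       = P₂.patterns (leaves-fill⁺ I₂ P∈I₂ (here refl))
  ...   | inj₂ (here refl) = resolvent-wellFormed aux P₁.wf x₁∉s₁ P₂.wf x₂∉s₂

  only-in-LA₃ : ∀ {z} → z ∈ symbLits (I₁ [ I₂ [ leaf P₃ ] ]) → ¬ IneqAux z
  only-in-LA₃ z∈ with symbLits-fill⁻ I₁ z∈
  ... | inj₁ z∈I₁ = P₁.only-in-LA (symbLits-fill⁺ I₁ z∈I₁)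
  ... | inj₂ z∈′ with symbLits-fill⁻ I₂ z∈′
  ...   | inj₁ z∈I₂ = P₂.only-in-LA (symbLits-fill⁺ I₂ z∈I₂)
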